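{- Let $G$ be a plane triangulation with $n$ vertices and minimum degree $\delta(G)\ge 4$, and suppose $G$ contains a Hamilton cycle $H$. Then $\gamma(G)\le \max\{\lceil 2n/7\rceil, \lfloor 5n/16\rfloor\}$.
   Context: $\gamma(G)$ denotes the domination number of $G$, i.e. the minimum size of a set $D\subseteq V(G)$ such that every vertex of $G$ is in $D$ or adjacent to a vertex of $D$. A plane triangulation is a simple planar graph embedded in the plane in which every face (including the outer face) is bounded by a triangle. -}

module Defs where

open import Data.Nat using (ℕ; zero; suc; _+_; _*_; _≤_; _⊔_; _/_)
open import Data.Fin using (Fin; toℕ)
open import Data.List using (List; length)
open import Data.List.Membership.Propositional using (_∈_)
open import Data.Product using (Σ; ∃; ∃-syntax; _×_; _,_)
open import Data.Sum using (_⊎_)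
open import Relation.Nullary using (¬_)
open import Relation.Binary.PropositionalEquality using (_≡_; _≢_)
open import Function using (_∘_)
open import Function.Definitions using (Injective)

iter : ∀ {A : Set} → (A → A) → ℕ → A → A
iter f zero    x = x
iter f (suc k) x = f (iter f k x)

data Reach {m : ℕ} (σ α : Fin m → Fin m) : Fin m → Fin m → Set where
  here  : ∀ {d} → Reach σ α d d
  viaσ  : ∀ {d e} → Reach σ α (σ d) e → Reach σ α d e
  viaα  : ∀ {d e} → Reach σ α (α d) e → Reach σ α d e

-- A plane triangulation on the vertex set Fin n, given combinatorially as
-- a (connected, orientable) combinatorial map / rotation system with
-- m darts (half-edges):
--   α : the edge involution (fixed-point free),
--   σ : the rotation (a permutation whose cycles are the vertex rotations),
--   tail d : the vertex at which dart d starts.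
-- Faces are the cycles of φ = σ ∘ α.  The embedding is in the plane
-- (sphere) iff the map is connected and Euler's formula V - E + F = 2 holds.
record PlaneTriangulation (n : ℕ) : Set where
  field
    m      : ℕ
    α      : Fin m → Fin m
    σ      : Fin m → Fin m
    tail   : Fin m → Fin n
    α-invol : ∀ d → α (α d) ≡ d
    α-nofix : ∀ d → α d ≢ d
    σ-inj   : Injective _≡_ _≡_ σ
    σ-tail  : ∀ d → tail (σ d) ≡ tail d
    σ-orbit : ∀ d d' → tail d ≡ tail d' → ∃[ k ] iter σ k d ≡ d'
    tail-surj : ∀ v → ∃[ d ] tail d ≡ v
    noLoop  : ∀ d → tail (α d) ≢ tail d
    noMulti : ∀ d d' → tail d ≡ tail d' → tail (α d) ≡ tail (α d') → d ≡ d'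
    face3   : ∀ d → (σ ∘ α) ((σ ∘ α) ((σ ∘ α) d)) ≡ d
    faceNo1 : ∀ d → (σ ∘ α) d ≢ d
    connected : ∀ d d' → Reach σ α d d'
    euler : ∃[ e ] ∃[ f ] (2 * e ≡ m × 3 * f ≡ m × n + f ≡ e + 2)

module _ {n : ℕ} (G : PlaneTriangulation n) where
  open PlaneTriangulation G

  Adj : Fin n → Fin n → Set
  Adj u v = ∃[ d ] (tail d ≡ u × tail (α d) ≡ v)

  MinDegreeAtLeast : ℕ → Set
  MinDegreeAtLeast k = ∀ v → ∃[ f ] (Injective _≡_ _≡_ f × (∀ (i : Fin k) → Adj v (f i)))

  HamiltonCycle : Set
  HamiltonCycle =
    3 ≤ n × (∃[ h ] (Injective _≡_ _≡_ h ×
      (∀ (i j : Fin n) → (suc (toℕ i) ≡ toℕ j ⊎ (suc (toℕ i) ≡ n × toℕ j ≡ 0))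
                       → Adj (h i) (h j))))

  Dominating : List (Fin n) → Set
  Dominating D = ∀ v → v ∈ D ⊎ ∃[ u ] (u ∈ D × Adj u v)

  DominationNumberAtMost : ℕ → Set
  DominationNumberAtMost k = ∃[ D ] (Dominating D × length D ≤ k)

bound : ℕ → ℕ
bound n = ((2 * n + 6) / 7) ⊔ ((5 * n) / 16)

{-# OPTIONS --safe #-}

-- The Hamilton cycle cuts the sphere into two triangulated discs. The dual graph of a disc is a
-- tree, so the disc has a 4-colouring in which any two adjacent triangles carry all four colours;
-- a colour class dominates everything except the ears (vertices in a single triangle of the disc)
-- which miss the colour. Adding these ears, the best class has at most (n + t) / 4 vertices, where
-- t is the number of ears of the disc. On the other hand the two neighbours on the cycle of an ear
-- are adjacent, so that walking along the cycle one may greedily dominate stretches of 3, 4 or 5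
-- vertices. By minimum degree 4 no vertex is an ear on both sides, and then many ears on both sides
-- mean long stretches: 5 |D| ≤ 2n - t - t′ + 2, or 4 |D| ≤ n + 3 if no two consecutive vertices
-- are both non-ears. One of these sets is small enough.
module Submission where

open import Defs
open import Data.Bool using (true; false; if_then_else_)
open import Data.Empty using (⊥; ⊥-elim)
open import Data.Fin using (Fin; zero; suc; toℕ; punchIn; punchOut)
open import Data.Fin.Patterns using (0F; 1F; 2F; 3F)
import Data.Fin.Permutation as Perm
open import Data.Fin.Properties
  using (_≟_; all?; any?; toℕ-injective; toℕ-fromℕ<; toℕ<n; injective⇒≤; punchInᵢ≢i;
         punchOut-cong; punchOut-injective; punchOut-punchIn)
open import Data.List using (List; []; _∷_; _++_; length; filter; tabulate; concat; allFin)
open import Data.List.Membership.Propositional using (_∈_)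
open import Data.List.Membership.Propositional.Properties
  using (∈-++⁺ˡ; ∈-++⁺ʳ; ∈-concat⁺′; ∈-tabulate⁺; ∈-filter⁺; ∈-allFin)
open import Data.List.Properties using (length-++; length-tabulate)
open import Data.List.Relation.Unary.Any using (here; there)
open import Data.Nat using (ℕ; zero; suc; _+_; _*_; _≤_; _<_; z≤n; s≤s; _/_; _%_)
open import Data.Nat.DivMod
  using (_mod_; m≡m%n+[m/n]*n; m%n<n; m%n%n≡m%n; m<n⇒m%n≡m; n%n≡0; [m+n]%n≡m%n; [m+kn]%n≡m%n;
         m*n%n≡0; %-distribˡ-+)
open import Data.Nat.Induction using (<-rec)
open import Data.Nat.Properties hiding (_≟_)
open import Data.Nat.Tactic.RingSolver using (solve-∀)
open import Data.Product using (∃-syntax; _×_; _,_; proj₁; proj₂)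
open import Data.Sum using (_⊎_; inj₁; inj₂; [_,_]′; swap)
open import Function using (_∘_)
open import Function.Definitions using (Injective)
open import Relation.Binary using (tri<; tri≈; tri>)
open import Relation.Binary.PropositionalEquality
open import Relation.Nullary using (Dec; yes; no; does; ¬_)
open import Relation.Nullary.Decidable using (toWitness; _⊎-dec_; _×-dec_; ¬?)
open import Relation.Unary using (Decidable)
open import Algebra.Properties.CommutativeMonoid.Sum +-0-commutativeMonoid
  using (sum; sum-permute; sum-cong-≗; ∑-distrib-+; ∑-comm)

-- Indicators, finite sums and double counting.

𝟙 : {A : Set} → Dec A → ℕ
𝟙 (yes _) = 1
𝟙 (no _) = 0

𝟙-true : {A : Set} (P? : Dec A) → A → 𝟙 P? ≡ 1
𝟙-true (yes _) _ = refl
𝟙-true (no ¬p) p = ⊥-elim (¬p p)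

𝟙-false : {A : Set} (P? : Dec A) → ¬ A → 𝟙 P? ≡ 0
𝟙-false (yes p) ¬p = ⊥-elim (¬p p)
𝟙-false (no _) _ = refl

when : {A B : Set} → Dec A → List B → List B
when (yes _) xs = xs
when (no _) xs = []

∈-when : {A B : Set} {x : B} {xs : List B} (P? : Dec A) → A → x ∈ xs → x ∈ when P? xs
∈-when (yes _) _ x∈ = x∈
∈-when (no ¬p) p _ = ⊥-elim (¬p p)

length-when : {A B : Set} (P? : Dec A) (xs : List B) → length (when P? xs) ≡ 𝟙 P? * length xs
length-when (yes _) xs = sym (+-identityʳ _)
length-when (no _) xs = refl

sum-mono : ∀ {n} {f g : Fin n → ℕ} → (∀ i → f i ≤ g i) → sum f ≤ sum g
sum-mono {zero} f≤g = z≤n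
sum-mono {suc n} f≤g = +-mono-≤ (f≤g zero) (sum-mono (f≤g ∘ suc))

sum-const : ∀ n k → sum {n} (λ _ → k) ≡ n * k
sum-const zero k = refl
sum-const (suc n) k = cong (k +_) (sum-const n k)

term≤sum : ∀ {n} (f : Fin n → ℕ) (i : Fin n) → f i ≤ sum f
term≤sum f zero = m≤m+n _ _
term≤sum f (suc i) = ≤-trans (term≤sum (f ∘ suc) i) (m≤n+m _ _)

sum-reindex : ∀ {n} (f : Fin n → ℕ) (π π⁻¹ : Fin n → Fin n) →
  (∀ i → π (π⁻¹ i) ≡ i) → (∀ i → π⁻¹ (π i) ≡ i) → sum (f ∘ π) ≡ sum f
sum-reindex f π π⁻¹ ππ⁻¹ π⁻¹π = sym (sum-permute f
  (Perm.permutation π π⁻¹ ππ⁻¹ π⁻¹π))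

sum-unique : ∀ {k} {A : Set} {Q : Fin k → Set} (Q? : Decidable Q) (P? : Dec A) →
  (∀ i → Q i → A) → (∀ i j → Q i → Q j → i ≡ j) → sum (λ i → 𝟙 (Q? i)) ≤ 𝟙 P?
sum-unique {k = zero} Q? P? Q⇒P uniq = z≤n
sum-unique {k = suc k} Q? P? Q⇒P uniq with Q? zero
... | no _ = sum-unique (Q? ∘ suc) P? (Q⇒P ∘ suc) λ i j qi qj → suc-inj (uniq _ _ qi qj)
  where
  suc-inj : {i j : Fin k} → Fin.suc i ≡ suc j → i ≡ j
  suc-inj refl = refl
... | yes q = begin
  1 + sum (λ i → 𝟙 (Q? (suc i))) ≤⟨ +-monoʳ-≤ 1 (sum-mono λ i → ≤-reflexive (𝟙-false (Q? (suc i)) (zero≢suc i))) ⟩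
  1 + sum {k} (λ _ → 0)          ≡⟨ cong suc (trans (sum-const k 0) (*-zeroʳ k)) ⟩
  1                              ≡⟨ 𝟙-true P? (Q⇒P zero q) ⟨
  𝟙 P?                           ∎
  where
  open ≤-Reasoning
  zero≢suc : ∀ i → ¬ _
  zero≢suc i q′ with () ← uniq zero (suc i) q q′

-- Double counting of the pairs with `f i ≡ d`: every `i` contributes a pair, and by injectivity
-- every `d` satisfying `P` occurs in at most one.
injection-count : ∀ {k l} {P : Fin l → Set} (P? : Decidable P) (f : Fin k → Fin l) →
  Injective _≡_ _≡_ f → (∀ i → P (f i)) → k ≤ sum (λ d → 𝟙 (P? d))
injection-count {k} {l} P? f f-inj Pf = begin
  k                                          ≡⟨ trans (sum-const k 1) (*-identityʳ k) ⟨
  sum {k} (λ _ → 1)                          ≤⟨ sum-mono (λ i → ≤-trans (≤-reflexive (sym (𝟙-true (f i ≟ f i) refl)))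
                                                  (term≤sum (λ d → 𝟙 (f i ≟ d)) (f i))) ⟩
  sum (λ i → sum (λ d → 𝟙 (f i ≟ d)))        ≡⟨ ∑-comm (λ i d → 𝟙 (f i ≟ d)) ⟩
  sum (λ d → sum (λ i → 𝟙 (f i ≟ d)))        ≤⟨ sum-mono (λ d → sum-unique (λ i → f i ≟ d) (P? d)
                                                  (λ i → λ { refl → Pf i }) λ i j p q → f-inj (trans p (sym q))) ⟩
  sum (λ d → 𝟙 (P? d))                       ∎
  where open ≤-Reasoning

length-filter-tabulate : ∀ {n} {A : Set} {P : A → Set} (P? : Decidable P) (f : Fin n → A) →
  length (filter P? (tabulate f)) ≡ sum (λ i → 𝟙 (P? (f i)))
length-filter-tabulate {n = zero} P? f = refl
length-filter-tabulate {n = suc n} P? f with P? (f zero)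
... | yes _ = cong suc (length-filter-tabulate P? (f ∘ suc))
... | no _ = length-filter-tabulate P? (f ∘ suc)

length-concat-tabulate : ∀ {n} {A : Set} (f : Fin n → List A) →
  length (concat (tabulate f)) ≡ sum (λ i → length (f i))
length-concat-tabulate {n = zero} f = refl
length-concat-tabulate {n = suc n} f =
  trans (length-++ (f zero)) (cong (length (f zero) +_) (length-concat-tabulate (f ∘ suc)))

sum-colour-classes : ∀ {k} {A : Set} (f : A → Fin k) (xs : List A) →
  sum (λ c → length (filter (λ x → f x ≟ c) xs)) ≡ length xs
sum-colour-classes {k = k} f [] = trans (sum-const k 0) (*-zeroʳ k)
sum-colour-classes {k = k} f (x ∷ xs) = begin
  sum (λ c → length (filter (λ y → f y ≟ c) (x ∷ xs)))        ≡⟨ sum-cong-≗ step ⟩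
  sum (λ c → 𝟙 (f x ≟ c) + length (filter (λ y → f y ≟ c) xs)) ≡⟨ ∑-distrib-+ (λ c → 𝟙 (f x ≟ c)) _ ⟩
  sum (λ c → 𝟙 (f x ≟ c)) + _                                 ≡⟨ cong₂ _+_ single (sum-colour-classes f xs) ⟩
  suc (length xs)                                             ∎
  where
  open ≡-Reasoning
  step : ∀ c → length (filter (λ y → f y ≟ c) (x ∷ xs)) ≡ 𝟙 (f x ≟ c) + length (filter (λ y → f y ≟ c) xs)
  step c with f x ≟ c
  ... | yes _ = refl
  ... | no _ = refl
  single : sum (λ c → 𝟙 (f x ≟ c)) ≡ 1
  single = ≤-antisym
    (sum-unique (λ c → f x ≟ c) (yes x) (λ _ _ → x) (λ _ _ p q → trans (sym p) q))
    (≤-trans (≤-reflexive (sym (𝟙-true (f x ≟ f x) refl))) (term≤sum (λ c → 𝟙 (f x ≟ c)) (f x)))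

smallest-term : ∀ {n} (f : Fin (suc n) → ℕ) → ∃[ i ] suc n * f i ≤ sum f
smallest-term {n} f = let i , f-min = minimum f in
  i , ≤-trans (≤-reflexive (sym (sum-const (suc n) (f i)))) (sum-mono f-min)
  where
  minimum : ∀ {n} (f : Fin (suc n) → ℕ) → ∃[ i ] (∀ j → f i ≤ f j)
  minimum {zero} f = zero , λ { zero → ≤-refl }
  minimum {suc n} f with minimum (f ∘ suc)
  ... | i , f-min with ≤-total (f zero) (f (suc i))
  ...   | inj₁ z≤ = zero , λ { zero → ≤-refl ; (suc j) → ≤-trans z≤ (f-min j) }
  ...   | inj₂ ≤z = suc i , λ { zero → ≤z ; (suc j) → f-min j }

merge : ∀ {n} {a b : Fin (suc n)} → b ≢ a → Fin (suc n) → Fin n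
merge {a = a} {b} b≢a z with b ≟ z
... | yes _ = punchOut b≢a
... | no b≢z = punchOut b≢z

merge-identifies : ∀ {n} {a b : Fin (suc n)} (b≢a : b ≢ a) → merge b≢a a ≡ merge b≢a b
merge-identifies {a = a} {b} b≢a with b ≟ a | b ≟ b
... | yes b≡a | _ = ⊥-elim (b≢a b≡a)
... | no b≢a′ | yes _ = punchOut-cong b refl
... | no _ | no b≢b = ⊥-elim (b≢b refl)

merge-surjective : ∀ {n} {a b : Fin (suc n)} (b≢a : b ≢ a) (c : Fin n) → merge b≢a (punchIn b c) ≡ c
merge-surjective {b = b} b≢a c with b ≟ punchIn b c
... | yes b≡ = ⊥-elim (punchInᵢ≢i b c (sym b≡))
... | no b≢ = trans (punchOut-cong b refl) (punchOut-punchIn b)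

-- The map `act x y` takes `x` to `y` and commutes with every transport, so a whole component can be
-- corrected by it without disturbing the edges inside.
module Potentials (X T : Set) (transport : T → X → X)
  (act : X → X → X → X) (act-hits : ∀ x y → act x y x ≡ y)
  (act-equivariant : ∀ x y t z → act x y (transport t z) ≡ transport t (act x y z))
  where

  Edge : ℕ → Set
  Edge n = Fin n × Fin n × T

  -- Union-find over a list of edges: an edge joining two components merges them after transforming
  -- the values on one of them by a symmetry; an edge inside a component is redundant, and is only
  -- counted (second case of flat).
  record Potential (n : ℕ) (L : List (Edge n)) : Set where
    field
      components : ℕ
      component : Fin n → Fin components
      component-surjective : ∀ c → ∃[ x ] component x ≡ c
      component-edge : ∀ {x y t} → (x , y , t) ∈ L → component x ≡ component y
      count : n ≤ components + length L
      value : Fin n → X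
      flat : (∀ {x y t} → (x , y , t) ∈ L → value y ≡ transport t (value x))
             ⊎ n < components + length L

  potential : ∀ {n} → X → (L : List (Edge n)) → Potential n L
  potential {n} x₀ [] = record
    { components = n
    ; component = λ x → x
    ; component-surjective = λ c → c , refl
    ; component-edge = λ ()
    ; count = ≤-reflexive (sym (+-identityʳ n))
    ; value = λ _ → x₀
    ; flat = inj₁ λ ()
    }
  potential {n} x₀ ((x , y , t) ∷ L) = extend (potential x₀ L)
    where
    extend : Potential n L → Potential n ((x , y , t) ∷ L)
    extend record { components = zero ; component = component } with () ← component x
    extend record { components = suc c ; component = component ; component-surjective = surj
                  ; component-edge = edge ; count = count ; value = value ; flat = flat }
      with component y ≟ component x
    ... | yes y~x = record
      { components = suc c
      ; component = component
      ; component-surjective = surj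
      ; component-edge = λ { (here refl) → sym y~x ; (there e) → edge e }
      ; count = ≤-trans count (+-monoʳ-≤ (suc c) (n≤1+n _))
      ; value = value
      ; flat = inj₂ (≤-trans (s≤s count) (≤-reflexive (sym (+-suc (suc c) (length L)))))
      }
    ... | no y≁x = record
      { components = c
      ; component = merge y≁x ∘ component
      ; component-surjective = λ i → let z , z↦ = surj (punchIn (component y) i) in
          z , trans (cong (merge y≁x) z↦) (merge-surjective y≁x i)
      ; component-edge = λ { (here refl) → merge-identifies y≁x ; (there e) → cong (merge y≁x) (edge e) }
      ; count = ≤-trans count shift
      ; value = value′
      ; flat = flat′ flat
      }
      where
      shift : suc c + length L ≤ c + suc (length L)
      shift = ≤-reflexive (sym (+-suc c (length L)))
      correction : X → X
      -- Chosen so that the new edge becomes flat; it is applied to all of the component of `y` and,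
      -- since `x` lies elsewhere, leaves the value at `x` alone.
      correction = act (value y) (transport t (value x))
      value′ : Fin n → X
      value′ z = if does (component y ≟ component z) then correction (value z) else value z
      new-edge : value′ y ≡ transport t (value′ x)
      new-edge with component y ≟ component y | component y ≟ component x
      ... | _ | yes y~x = ⊥-elim (y≁x y~x)
      ... | no y≁y | _ = ⊥-elim (y≁y refl)
      ... | yes _ | no _ = act-hits _ _
      -- Both ends lie in one component, so either both values are corrected or neither; in the
      -- first case equivariance preserves the relation.
      old-edge : ∀ u w s → component u ≡ component w → value w ≡ transport s (value u) →
        value′ w ≡ transport s (value′ u)
      old-edge u w s u~w eq rewrite u~w with does (component y ≟ component w)
      ... | true = trans (cong correction eq) (act-equivariant _ _ s _)
      ... | false = eq
      flat′ : _ → _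
      flat′ (inj₁ f) = inj₁ λ { (here refl) → new-edge ; (there e) → old-edge _ _ _ (edge e) (f e) }
      flat′ (inj₂ n<) = inj₂ (≤-trans n< shift)

-- Four colours as the field of four elements.

-- F₄ = {0, 1, ω, ω²}, numbered in this order

infixl 6 _⊕_
_⊕_ : Fin 4 → Fin 4 → Fin 4
0F ⊕ y = y
x ⊕ 0F = x
1F ⊕ 1F = 0F
1F ⊕ 2F = 3F
1F ⊕ 3F = 2F
2F ⊕ 1F = 3F
2F ⊕ 2F = 0F
2F ⊕ 3F = 1F
3F ⊕ 1F = 2F
3F ⊕ 2F = 1F
3F ⊕ 3F = 0F

turn : Fin 3 → Fin 3
turn 0F = 1F
turn 1F = 2F
turn 2F = 0F

ω^ : Fin 3 → Fin 4
ω^ 0F = 1F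
ω^ 1F = 2F
ω^ 2F = 3F

infixl 6 _⊞_ _⊟_
_⊞_ _⊟_ : Fin 3 → Fin 3 → Fin 3
0F ⊞ j = j
1F ⊞ j = turn j
2F ⊞ j = turn (turn j)
i ⊟ 0F = i
i ⊟ 1F = turn (turn i)
i ⊟ 2F = turn i

scale : Fin 3 → Fin 4 → Fin 4
scale i 0F = 0F
scale i 1F = ω^ i
scale i 2F = ω^ (turn i)
scale i 3F = ω^ (turn (turn i))

-- (t , i) describes a dart of tail colour t and head colour t + ωⁱ whose face has third
-- colour t + ωⁱ⁺¹; the fourth colour is t + ωⁱ⁺², the third one on the other side of the dart.
Frame : Set
Frame = Fin 4 × Fin 3

data Step : Set where
  along across : Step

-- Since ωⁱ + ωⁱ⁺¹ = ωⁱ⁺², the next dart of the face has direction i + 2. Reversing a dart keeps its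
-- direction because -1 = 1, and this is what gives the triangle beyond it the fourth colour.
transport : Step → Frame → Frame
transport along (t , i) = t ⊕ ω^ i , turn (turn i)
transport across (t , i) = t ⊕ ω^ i , i

-- The affine map z ↦ t′ + ω^(i′-i) (z - t), where minus is plus in characteristic two. The twelve
-- affine maps of F₄ permute the twelve frames simply transitively.
act : Frame → Frame → Frame → Frame
act (t , i) (t′ , i′) (z , j) = t′ ⊕ scale (i′ ⊟ i) (z ⊕ t) , j ⊞ (i′ ⊟ i)

act-hits : ∀ x y → act x y x ≡ y
act-hits (t , i) (t′ , i′) = cong₂ _,_ (first t t′ (i′ ⊟ i)) (second i i′)
  where
  first : ∀ t t′ k → t′ ⊕ scale k (t ⊕ t) ≡ t′
  first = toWitness {a? = all? λ t → all? λ t′ → all? λ k → t′ ⊕ scale k (t ⊕ t) ≟ t′} _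
  second : ∀ i i′ → i ⊞ (i′ ⊟ i) ≡ i′
  second = toWitness {a? = all? λ i → all? λ i′ → i ⊞ (i′ ⊟ i) ≟ i′} _

act-equivariant : ∀ x y s z → act x y (transport s z) ≡ transport s (act x y z)
act-equivariant (t , i) (t′ , i′) s (z , j) = case s
  where
  colours : ∀ t t′ z j k → t′ ⊕ scale k ((z ⊕ ω^ j) ⊕ t) ≡ (t′ ⊕ scale k (z ⊕ t)) ⊕ ω^ (j ⊞ k)
  colours = toWitness {a? = all? λ t → all? λ t′ → all? λ z → all? λ j → all? λ k →
    t′ ⊕ scale k ((z ⊕ ω^ j) ⊕ t) ≟ (t′ ⊕ scale k (z ⊕ t)) ⊕ ω^ (j ⊞ k)} _
  directions : ∀ j k → turn (turn j) ⊞ k ≡ turn (turn (j ⊞ k))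
  directions = toWitness {a? = all? λ j → all? λ k → turn (turn j) ⊞ k ≟ turn (turn (j ⊞ k))} _
  case : ∀ s → act (t , i) (t′ , i′) (transport s (z , j)) ≡ transport s (act (t , i) (t′ , i′) (z , j))
  case along = cong₂ _,_ (colours t t′ z j (i′ ⊟ i)) (directions j (i′ ⊟ i))
  case across = cong₂ _,_ (colours t t′ z j (i′ ⊟ i)) refl

along³ : ∀ x → transport along (transport along (transport along x)) ≡ x
along³ (t , i) = cong₂ _,_ (colours t i) (directions i)
  where
  colours : ∀ t i → proj₁ (transport along (transport along (transport along (t , i)))) ≡ t
  colours = toWitness {a? = all? λ t → all? λ i →
    proj₁ (transport along (transport along (transport along (t , i)))) ≟ t} _
  directions : ∀ i → turn (turn (turn (turn (turn (turn i))))) ≡ i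
  directions = toWitness {a? = all? λ i → turn (turn (turn (turn (turn (turn i))))) ≟ i} _

across² : ∀ x → transport across (transport across x) ≡ x
across² (t , i) = cong₂ _,_ (colours t i) refl
  where
  colours : ∀ t i → (t ⊕ ω^ i) ⊕ ω^ i ≡ t
  colours = toWitness {a? = all? λ t → all? λ i → (t ⊕ ω^ i) ⊕ ω^ i ≟ t} _

four-colours : ∀ t i c → ((c ≡ t) ⊎ (c ≡ t ⊕ ω^ i)) ⊎ ((c ≡ t ⊕ ω^ (turn i)) ⊎ (c ≡ t ⊕ ω^ (turn (turn i))))
four-colours = toWitness {a? = all? λ t → all? λ i → all? λ c →
  ((c ≟ t) ⊎-dec (c ≟ t ⊕ ω^ i)) ⊎-dec ((c ≟ t ⊕ ω^ (turn i)) ⊎-dec (c ≟ t ⊕ ω^ (turn (turn i))))} _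

open Potentials Frame Step transport act act-hits act-equivariant

<-toℕ : ∀ {k m} {x y : Fin m} → x ≡ y → k < toℕ x → k < toℕ y
<-toℕ refl k< = k<

iter-suc : {A : Set} (f : A → A) (k : ℕ) (x : A) → iter f k (f x) ≡ f (iter f k x)
iter-suc f zero x = refl
iter-suc f (suc k) x = cong f (iter-suc f k x)

two-valued⇒≤2 : ∀ {c} (a b : Fin c) → (∀ i → i ≡ a ⊎ i ≡ b) → c ≤ 2
two-valued⇒≤2 {zero} a b cover = z≤n
two-valued⇒≤2 {suc zero} a b cover = s≤s z≤n
two-valued⇒≤2 {suc (suc zero)} a b cover = ≤-refl
two-valued⇒≤2 {suc (suc (suc c))} a b cover with cover 0F | cover 1F | cover 2F
... | inj₁ refl | inj₁ () | _
... | inj₁ refl | inj₂ refl | inj₁ ()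
... | inj₁ refl | inj₂ refl | inj₂ ()
... | inj₂ refl | inj₂ () | _
... | inj₂ refl | inj₁ refl | inj₁ ()
... | inj₂ refl | inj₁ refl | inj₂ ()

constant⇒≤1 : ∀ {c} (a : Fin c) → (∀ i → i ≡ a) → c ≤ 1
constant⇒≤1 {suc zero} a all≡ = ≤-refl
constant⇒≤1 {suc (suc c)} a all≡ with () ← trans (all≡ 0F) (sym (all≡ 1F))

-- Faces of the triangulation and Euler's formula.

module _ {n : ℕ} (G : PlaneTriangulation n) where
  open PlaneTriangulation G

  φ : Fin m → Fin m
  φ d = σ (α d)

  φα : ∀ d → φ (α d) ≡ σ d
  φα d = cong σ (α-invol d)

  tail-φ : ∀ d → tail (φ d) ≡ tail (α d)
  tail-φ d = σ-tail (α d)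

  tail-α-φφ : ∀ d → tail (α (φ (φ d))) ≡ tail d
  tail-α-φφ d = trans (sym (tail-φ (φ (φ d)))) (cong tail (face3 d))

  adj-sym : ∀ {u v} → Adj G u v → Adj G v u
  adj-sym (d , refl , refl) = α d , refl , cong tail (α-invol d)

  φφ≢ : ∀ d → φ (φ d) ≢ d
  φφ≢ d eq = faceNo1 d (trans (cong φ (sym eq)) (face3 d))

  -- Each face is represented by its dart of least index.
  Rep : Fin m → Set
  Rep d = toℕ d < toℕ (φ d) × toℕ d < toℕ (φ (φ d))

  rep? : Decidable Rep
  rep? d = (toℕ d <? toℕ (φ d)) ×-dec (toℕ d <? toℕ (φ (φ d)))

  rep-exists : ∀ d → Rep d ⊎ Rep (φ d) ⊎ Rep (φ (φ d))
  rep-exists d with <-cmp (toℕ d) (toℕ (φ d)) | <-cmp (toℕ (φ d)) (toℕ (φ (φ d))) | <-cmp (toℕ d) (toℕ (φ (φ d)))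
  ... | tri≈ _ eq _ | _ | _ = ⊥-elim (faceNo1 d (sym (toℕ-injective eq)))
  ... | _ | tri≈ _ eq _ | _ = ⊥-elim (faceNo1 (φ d) (sym (toℕ-injective eq)))
  ... | _ | _ | tri≈ _ eq _ = ⊥-elim (φφ≢ d (sym (toℕ-injective eq)))
  ... | tri< a _ _ | _ | tri< b _ _ = inj₁ (a , b)
  ... | tri> _ _ a | tri< b _ _ | _ = inj₂ (inj₁ (b , <-toℕ (sym (face3 d)) a))
  ... | _ | tri> _ _ a | tri> _ _ b =
    inj₂ (inj₂ (<-toℕ (sym (face3 d)) b ,
                <-toℕ (cong φ (sym (face3 d))) a))
  ... | tri> _ _ c | tri> _ _ a | tri< b _ _ = ⊥-elim (<-irrefl refl (<-trans c (<-trans b a)))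
  ... | tri< c _ _ | tri< a _ _ | tri> _ _ b = ⊥-elim (<-irrefl refl (<-trans c (<-trans a b)))

  -- From the representative of a face, `base` serves the first two darts and `close` derives the
  -- third. This allows only two graph edges per face to be listed.
  φ-closure : (Good : Fin m → Set) → (∀ d → Rep d → Good d × Good (φ d)) →
    (∀ d → Good d → Good (φ d) → Good (φ (φ d))) → ∀ d → Good d
  φ-closure Good base close d with rep-exists d
  ... | inj₁ r = proj₁ (base d r)
  ... | inj₂ (inj₁ r) = subst Good (face3 d) (close (φ d) (proj₁ (base _ r)) (proj₂ (base _ r)))
  ... | inj₂ (inj₂ r) = subst Good (face3 d) (proj₂ (base _ r))

  -- Shifting the summation by `φ` and by `φ ∘ φ` gives three equal sums, and the three darts of a
  -- face include at most one representative.
  rep-count : 3 * sum (λ d → 𝟙 (rep? d)) ≤ m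
  rep-count = begin
    3 * R                                   ≡⟨ cong (λ x → R + (R + x)) (+-identityʳ R) ⟩
    R + (R + R)                             ≡⟨ cong₂ (λ x y → R + (x + y))
                                                 (sum-reindex r φ (φ ∘ φ) face3 face3)
                                                 (sum-reindex r (φ ∘ φ) φ face3 face3) ⟨
    R + (sum (r ∘ φ) + sum (r ∘ φ ∘ φ))     ≡⟨ cong (R +_) (∑-distrib-+ (r ∘ φ) (r ∘ φ ∘ φ)) ⟨
    R + sum (λ d → r (φ d) + r (φ (φ d)))   ≡⟨ ∑-distrib-+ r (λ d → r (φ d) + r (φ (φ d))) ⟨
    sum (λ d → r d + (r (φ d) + r (φ (φ d)))) ≤⟨ sum-mono at-most-one ⟩
    sum {m} (λ _ → 1)                       ≡⟨ trans (sum-const m 1) (*-identityʳ m) ⟩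
    m                                       ∎
    where
    open ≤-Reasoning
    r : Fin m → ℕ
    r d = 𝟙 (rep? d)
    R : ℕ
    R = sum r
    at-most-one : ∀ d → r d + (r (φ d) + r (φ (φ d))) ≤ 1
    at-most-one d with rep? d | rep? (φ d) | rep? (φ (φ d))
    ... | yes (a , _) | yes (_ , b) | _ = ⊥-elim (<-asym a (<-toℕ (face3 d) b))
    ... | yes (_ , a) | _ | yes (b , _) = ⊥-elim (<-asym a (<-toℕ (face3 d) b))
    ... | _ | yes (a , _) | yes (_ , b) = ⊥-elim (<-asym a (<-toℕ (cong φ (face3 d)) b))
    ... | yes _ | no _ | no _ = ≤-refl
    ... | no _ | yes _ | no _ = ≤-refl
    ... | no _ | no _ | yes _ = ≤-refl
    ... | no _ | no _ | no _ = z≤n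

  -- Six times Euler's formula, with edges and faces expressed through darts, reads 6n + 2m = 3m +
  -- 12.
  darts+12 : m + 12 ≡ 6 * n
  darts+12 with e , f , 2e≡m , 3f≡m , n+f≡e+2 ← euler =
    sym (+-cancelʳ-≡ (2 * m) _ _ (begin
      6 * n + 2 * m       ≡⟨ cong (λ x → 6 * n + 2 * x) 3f≡m ⟨
      6 * n + 2 * (3 * f) ≡⟨ lhs n f ⟩
      6 * (n + f)         ≡⟨ cong (6 *_) n+f≡e+2 ⟩
      6 * (e + 2)         ≡⟨ rhs e ⟩
      3 * (2 * e) + 12    ≡⟨ cong (λ x → 3 * x + 12) 2e≡m ⟩
      3 * m + 12          ≡⟨ split m ⟩
      m + 12 + 2 * m      ∎))
    where
    open ≡-Reasoning
    lhs : ∀ n f → 6 * n + 2 * (3 * f) ≡ 6 * (n + f)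
    lhs = solve-∀
    rhs : ∀ e → 6 * (e + 2) ≡ 3 * (2 * e) + 12
    rhs = solve-∀
    split : ∀ m → 3 * m + 12 ≡ m + 12 + 2 * m
    split = solve-∀

  -- The Hamilton cycle and its two sides.

  -- The darts `h v` and `g v` lead from `v` to its successor and to its predecessor. That `nxt` has
  -- a single orbit is encoded in `cyclic` by invariant functions being constant.
  record Cycle : Set where
    field
      nxt prv : Fin n → Fin n
      h g : Fin n → Fin m
      tail-h : ∀ v → tail (h v) ≡ v
      tail-g : ∀ v → tail (g v) ≡ v
      α-h : ∀ v → α (h v) ≡ g (nxt v)
      α-g : ∀ v → α (g v) ≡ h (prv v)
      nxt-prv : ∀ v → nxt (prv v) ≡ v
      prv-nxt : ∀ v → prv (nxt v) ≡ v
      nxt≢prv : ∀ v → nxt v ≢ prv v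
      cyclic : ∀ {k} (f : Fin n → Fin k) → (∀ v → f (nxt v) ≡ f v) → ∀ u v → f u ≡ f v

    h≢g : ∀ v → h v ≢ g v
    h≢g v eq = nxt≢prv v (trans (sym (tail-g _)) (trans (cong tail (trans (sym (α-h v)) (trans (cong α eq) (α-g v)))) (tail-h _)))

    h-inj : Injective _≡_ _≡_ h
    h-inj {u} {v} eq = trans (sym (tail-h u)) (trans (cong tail eq) (tail-h v))

    g-inj : Injective _≡_ _≡_ g
    g-inj {u} {v} eq = trans (sym (tail-g u)) (trans (cong tail eq) (tail-g v))

    adj-nxt : ∀ v → Adj G v (nxt v)
    adj-nxt v = h v , tail-h v , trans (cong tail (α-h v)) (tail-g (nxt v))

  -- Changing the direction exchanges the two sides, so all results about one side carry over to the
  -- other.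
  reverse : Cycle → Cycle
  reverse C = record
    { nxt = prv ; prv = nxt ; h = g ; g = h ; tail-h = tail-g ; tail-g = tail-h
    ; α-h = α-g ; α-g = α-h ; nxt-prv = prv-nxt ; prv-nxt = nxt-prv
    ; nxt≢prv = λ v → nxt≢prv v ∘ sym
    ; cyclic = λ f f-prv → cyclic f λ v → trans (sym (f-prv (nxt v))) (cong f (prv-nxt v))
    }
    where open Cycle C

  module Sides (C : Cycle) where
    open Cycle C

    OnCycle : Fin m → Set
    OnCycle d = d ≡ h (tail d) ⊎ d ≡ g (tail d)

    onCycle? : Decidable OnCycle
    onCycle? d = (d ≟ h (tail d)) ⊎-dec (d ≟ g (tail d))

    h-onCycle : ∀ v → OnCycle (h v)
    h-onCycle v = inj₁ (cong h (sym (tail-h v)))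

    g-onCycle : ∀ v → OnCycle (g v)
    g-onCycle v = inj₂ (cong g (sym (tail-g v)))

    -- Turning about a vertex until the first cycle dart; no edge of the cycle is crossed on the
    -- way, so the walk stays on one side.
    data Walk : Fin m → Fin m → Set where
      stop : ∀ {y} → OnCycle y → Walk y y
      step : ∀ {y z} → ¬ OnCycle y → Walk (σ y) z → Walk y z

    walk-preserves : {A : Set} (f : Fin m → A) → (∀ y → ¬ OnCycle y → f (σ y) ≡ f y) →
      ∀ {y z} → Walk y z → f z ≡ f y
    walk-preserves f f-σ (stop _) = refl
    walk-preserves f f-σ (step ¬on w) = trans (walk-preserves f f-σ w) (f-σ _ ¬on)

    walk-start : ∀ {y z} → Walk y z → y ≡ z ⊎ ¬ OnCycle y
    walk-start (stop _) = inj₁ refl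
    walk-start (step ¬on _) = inj₂ ¬on

    walk-from : ∀ k y → OnCycle (iter σ k y) → ∃[ z ] (Walk y z × OnCycle z)
    walk-from k y on with onCycle? y
    walk-from k y on | yes on′ = y , stop on′ , on′
    walk-from zero y on | no ¬on = ⊥-elim (¬on on)
    walk-from (suc k) y on | no ¬on =
      let z , w , on′ = walk-from k (σ y) (subst OnCycle (sym (iter-suc σ k y)) on) in z , step ¬on w , on′

    walk-tail : ∀ {y z} → Walk y z → tail z ≡ tail y
    walk-tail = walk-preserves tail λ y _ → σ-tail y

    exit : ∀ y → Walk y (h (tail y)) ⊎ Walk y (g (tail y))
    exit y with k , eq ← σ-orbit y (h (tail y)) (sym (tail-h (tail y)))
      with walk-from k y (subst OnCycle (sym eq) (h-onCycle (tail y)))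
    ... | z , w , inj₁ z≡ = inj₁ (subst (Walk y) (trans z≡ (cong h (walk-tail w))) w)
    ... | z , w , inj₂ z≡ = inj₂ (subst (Walk y) (trans z≡ (cong g (walk-tail w))) w)

    -- If the walk from σ (h v) came back to h v, the whole rotation at v would avoid g v.
    fan : ∀ v → Walk (σ (h v)) (g v)
    fan v with exit (σ (h v)) | trans (σ-tail (h v)) (tail-h v)
    ... | inj₂ w | eq = subst (Walk _) (cong g eq) w
    ... | inj₁ w | eq = ⊥-elim (avoids (proj₂ orbit) (stays (proj₁ orbit)))
      where
      Before : Fin m → Set
      Before y = y ≡ h v ⊎ (¬ OnCycle y × Walk y (h v))
      enter : ∀ {y} → Walk y (h v) → Before y
      enter (stop _) = inj₁ refl
      enter (step ¬on w) = inj₂ (¬on , step ¬on w)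
      before-σ : ∀ {y} → Before y → Before (σ y)
      before-σ (inj₁ refl) = enter (subst (Walk _) (cong h eq) w)
      before-σ (inj₂ (_ , stop on)) = enter (subst (Walk _) (cong h eq) w)
      before-σ (inj₂ (_ , step _ w)) = enter w
      stays : ∀ k → Before (iter σ k (h v))
      stays zero = inj₁ refl
      stays (suc k) = before-σ (stays k)
      orbit : ∃[ k ] iter σ k (h v) ≡ g v
      orbit = σ-orbit (h v) (g v) (trans (tail-h v) (sym (tail-g v)))
      avoids : ∀ {y} → y ≡ g v → ¬ Before y
      avoids refl (inj₁ eq) = h≢g v (sym eq)
      avoids refl (inj₂ (¬on , _)) = ¬on (g-onCycle v)

    -- A labelling of the faces that does not change across edges off the cycle, and is thus an
    -- invariant of the sides.
    record SideLabel {k : ℕ} (label : Fin m → Fin k) : Set where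
      field
        label-φ : ∀ d → label (φ d) ≡ label d
        label-α : ∀ d → ¬ OnCycle d → label (α d) ≡ label d

      label-σ : ∀ d → ¬ OnCycle d → label (σ d) ≡ label d
      label-σ d ¬on = trans (cong label (sym (φα d))) (trans (label-φ (α d)) (label-α d ¬on))

      label-fan : ∀ v → label (g v) ≡ label (σ (h v))
      label-fan v = walk-preserves label label-σ (fan v)

      -- The fan at `v` links `g v` to `σ (h v)`, which lies in the face of `g (nxt v)`; so the
      -- label is handed on along the cycle.
      label-g : ∀ u v → label (g u) ≡ label (g v)
      label-g = cyclic (label ∘ g) λ v → sym (begin
        label (g v)         ≡⟨ label-fan v ⟩
        label (σ (h v))     ≡⟨ cong label (φα (h v)) ⟨
        label (φ (α (h v))) ≡⟨ label-φ (α (h v)) ⟩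
        label (α (h v))     ≡⟨ cong label (α-h v) ⟩
        label (g (nxt v))   ∎)
        where open ≡-Reasoning

  -- The four-colouring of one side and its dominating classes.

  module Colour (C : Cycle) where
    open Cycle C
    open Sides C
    module Reversed = Sides (reverse C)

    reverse-label : ∀ {k} {label : Fin m → Fin k} → SideLabel label → Reversed.SideLabel label
    reverse-label L = record { label-φ = label-φ ; label-α = λ d ¬on → label-α d (¬on ∘ swap) }
      where open SideLabel L

    Cross : Fin m → Set
    Cross d = ¬ OnCycle d × toℕ d < toℕ (α d)

    cross? : Decidable Cross
    cross? d = ¬? (onCycle? d) ×-dec (toℕ d <? toℕ (α d))

    onCycle-α : ∀ d → OnCycle d → OnCycle (α d)
    onCycle-α d (inj₁ d≡h) = subst OnCycle (sym (trans (cong α d≡h) (α-h _))) (g-onCycle _)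
    onCycle-α d (inj₂ d≡g) = subst OnCycle (sym (trans (cong α d≡g) (α-g _))) (h-onCycle _)

    α-offCycle : ∀ d → ¬ OnCycle d → ¬ OnCycle (α d)
    α-offCycle d ¬on on = ¬on (subst OnCycle (α-invol d) (onCycle-α (α d) on))

    α-closure : (Good : Fin m → Set) → (∀ d → Cross d → Good d) → (∀ d → Good d → Good (α d)) →
      ∀ d → ¬ OnCycle d → Good d
    α-closure Good base close d ¬on with <-cmp (toℕ d) (toℕ (α d))
    ... | tri< a _ _ = base d (¬on , a)
    ... | tri≈ _ eq _ = ⊥-elim (α-nofix d (sym (toℕ-injective eq)))
    ... | tri> _ _ a = subst Good (α-invol d) (close (α d) (base (α d)
        (α-offCycle d ¬on , <-toℕ (sym (α-invol d)) a)))

    -- The darts in `Cross`, their reverses, the darts `h v` and the darts `g v` form four disjoint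
    -- families.
    cross-count : 2 * sum (λ d → 𝟙 (cross? d)) + 2 * n ≤ m
    cross-count = begin
      2 * E + 2 * n ≡⟨ cong₂ _+_ (cong (E +_) (+-identityʳ E)) (cong (n +_) (+-identityʳ n)) ⟩
      E + E + (n + n)
        ≤⟨ +-mono-≤ (≤-reflexive (cong (E +_) (sym (sum-reindex x α α α-invol α-invol))))
                    (+-mono-≤ (injection-count on-h? h h-inj (λ v → cong h (sym (tail-h v))))
                              (injection-count on-g? g g-inj (λ v → cong g (sym (tail-g v))))) ⟩
      E + sum (x ∘ α) + (sum y + sum z)
        ≡⟨ cong₂ _+_ (∑-distrib-+ x (x ∘ α)) (∑-distrib-+ y z) ⟨
      sum (λ d → x d + x (α d)) + sum (λ d → y d + z d)
        ≡⟨ ∑-distrib-+ (λ d → x d + x (α d)) (λ d → y d + z d) ⟨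
      sum (λ d → x d + x (α d) + (y d + z d))
        ≤⟨ sum-mono (λ d → at-most-one d (cross? d) (cross? (α d)) (on-h? d) (on-g? d)) ⟩
      sum {m} (λ _ → 1) ≡⟨ trans (sum-const m 1) (*-identityʳ m) ⟩
      m ∎
      where
      open ≤-Reasoning
      on-h? : ∀ d → Dec (d ≡ h (tail d))
      on-h? d = d ≟ h (tail d)
      on-g? : ∀ d → Dec (d ≡ g (tail d))
      on-g? d = d ≟ g (tail d)
      x y z : Fin m → ℕ
      x d = 𝟙 (cross? d)
      y d = 𝟙 (on-h? d)
      z d = 𝟙 (on-g? d)
      E : ℕ
      E = sum x
      at-most-one : ∀ d (x? : Dec (Cross d)) (xα? : Dec (Cross (α d)))
        (y? : Dec (d ≡ h (tail d))) (z? : Dec (d ≡ g (tail d))) → 𝟙 x? + 𝟙 xα? + (𝟙 y? + 𝟙 z?) ≤ 1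
      at-most-one d _ _ (yes p) (yes q) = ⊥-elim (h≢g (tail d) (trans (sym p) q))
      at-most-one d (yes (_ , a)) (yes (_ , b)) _ _ = ⊥-elim (<-asym a (<-toℕ (α-invol d) b))
      at-most-one d (yes (¬on , _)) (no _) (yes p) (no _) = ⊥-elim (¬on (inj₁ p))
      at-most-one d (yes (¬on , _)) (no _) (no _) (yes p) = ⊥-elim (¬on (inj₂ p))
      at-most-one d (no _) (yes (¬on , _)) (yes p) (no _) = ⊥-elim (¬on (onCycle-α d (inj₁ p)))
      at-most-one d (no _) (yes (¬on , _)) (no _) (yes p) = ⊥-elim (¬on (onCycle-α d (inj₂ p)))
      at-most-one d (yes _) (no _) (no _) (no _) = ≤-refl
      at-most-one d (no _) (yes _) (no _) (no _) = ≤-refl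
      at-most-one d (no _) (no _) (yes _) (no _) = ≤-refl
      at-most-one d (no _) (no _) (no _) (yes _) = ≤-refl
      at-most-one d (no _) (no _) (no _) (no _) = z≤n

    -- A graph on the darts whose components are to be the two sides: a path through the three darts
    -- of each face, and one edge across each edge of the triangulation off the cycle. The third
    -- edge in a face would close a circuit and spoil the count.
    faceEdges crossEdges : Fin m → List (Edge m)
    faceEdges d = when (rep? d) ((d , φ d , along) ∷ (φ d , φ (φ d) , along) ∷ [])
    crossEdges d = when (cross? d) ((d , α d , across) ∷ [])

    edges : List (Edge m)
    edges = concat (tabulate λ d → faceEdges d ++ crossEdges d)

    face-∈ : ∀ d → Rep d → (d , φ d , along) ∈ edges × (φ d , φ (φ d) , along) ∈ edges
    face-∈ d r = include (here refl) , include (there (here refl))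
      where
      include : ∀ {e} → e ∈ _ → e ∈ edges
      include e∈ = ∈-concat⁺′ (∈-++⁺ˡ (∈-when (rep? d) r e∈)) (∈-tabulate⁺ d)

    cross-∈ : ∀ d → Cross d → (d , α d , across) ∈ edges
    cross-∈ d c = ∈-concat⁺′ (∈-++⁺ʳ (faceEdges d) (∈-when (cross? d) c (here refl))) (∈-tabulate⁺ d)

    -- There are at most 2m/3 edges inside faces and m/2 - n across, and 6n = m + 12 turns the total
    -- into m - 2. Multiplying by six and adding m + 12 keeps the computation in the natural
    -- numbers.
    edges-count : length edges + 2 ≤ m
    edges-count = *-cancelˡ-≤ 6 (+-cancelʳ-≤ (m + 12) _ _ (begin
      6 * (length edges + 2) + (m + 12)            ≡⟨ cong₂ (λ x y → 6 * (x + 2) + y) length-edges darts+12 ⟩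
      6 * (R * 2 + E + 2) + 6 * n                  ≡⟨ regroup R E n ⟩
      4 * (3 * R) + 3 * (2 * E + 2 * n) + 12       ≤⟨ +-monoˡ-≤ 12 (+-mono-≤ (*-monoʳ-≤ 4 rep-count) (*-monoʳ-≤ 3 cross-count)) ⟩
      4 * m + 3 * m + 12                           ≡⟨ collect m ⟩
      6 * m + (m + 12)                             ∎))
      where
      open ≤-Reasoning
      r x : Fin m → ℕ
      r d = 𝟙 (rep? d)
      x d = 𝟙 (cross? d)
      R E : ℕ
      R = sum r
      E = sum x
      twice : ∀ k → k * 2 ≡ k + k
      twice = solve-∀
      regroup : ∀ R E n → 6 * (R * 2 + E + 2) + 6 * n ≡ 4 * (3 * R) + 3 * (2 * E + 2 * n) + 12
      regroup = solve-∀
      collect : ∀ m → 4 * m + 3 * m + 12 ≡ 6 * m + (m + 12)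
      collect = solve-∀
      length-edges : length edges ≡ R * 2 + E
      length-edges = begin-equality
        length edges
          ≡⟨ length-concat-tabulate (λ d → faceEdges d ++ crossEdges d) ⟩
        sum (λ d → length (faceEdges d ++ crossEdges d))
          ≡⟨ sum-cong-≗ (λ d → trans (length-++ (faceEdges d)) (cong₂ _+_ (length-when (rep? d) _) (length-when (cross? d) _))) ⟩
        sum (λ d → r d * 2 + x d * 1)
          ≡⟨ sum-cong-≗ (λ d → cong₂ _+_ (twice (r d)) (*-identityʳ (x d))) ⟩
        sum (λ d → (r d + r d) + x d)
          ≡⟨ trans (∑-distrib-+ (λ d → r d + r d) x) (cong (_+ E) (∑-distrib-+ r r)) ⟩
        (R + R) + E
          ≡⟨ cong (_+ E) (twice R) ⟨
        R * 2 + E ∎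

    -- Here `sides≢` is a discrete Jordan curve theorem. The frames encode a four-colouring of each
    -- side separately, as nothing relates them across the cycle.
    record Framing : Set where
      field
        {sides} : ℕ
        side : Fin m → Fin sides
        sideLabel : SideLabel side
        sides≢ : ∀ u v → side (g u) ≢ side (h v)
        frame : Fin m → Frame
        frame-φ : ∀ d → frame (φ d) ≡ transport along (frame d)
        frame-α : ∀ d → ¬ OnCycle d → frame (α d) ≡ transport across (frame d)

    -- Both sides of the cycle are connected, so there are at most two components; as Euler's
    -- formula leaves at most m - 2 edges, none of them can be redundant.
    framing : Fin n → Framing
    framing v₀ = record
      { side = component
      ; sideLabel = label
      -- A common label of `g u` and `h v` would make all labels equal and leave one component,
      -- against `two≤c`.
      ; sides≢ = λ u v eq → <-irrefl refl (≤-trans two≤c (constant⇒≤1 (component (h v₀)) λ i →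
          [ (λ i≡ → trans i≡ (trans (label-g v₀ u) (trans eq (label-h v v₀)))) , (λ i≡ → i≡) ]′ (two-values i)))
      ; frame = value
      ; frame-φ = φ-closure (λ d → value (φ d) ≡ transport along (value d))
          (λ d r → flat₁ (proj₁ (face-∈ d r)) , flat₁ (proj₂ (face-∈ d r)))
          -- The third dart of a face is consistent because `along` has order three.
          (λ d p q → trans (cong value (face3 d)) (trans (sym (along³ (value d)))
            (cong (transport along) (sym (trans q (cong (transport along) p))))))
      ; frame-α = α-closure (λ d → value (α d) ≡ transport across (value d))
          (λ d c → flat₁ (cross-∈ d c))
          (λ d p → trans (cong value (α-invol d)) (trans (sym (across² (value d))) (cong (transport across) (sym p))))
      }
      where
      open Potential (potential (0F , 0F) edges)
      label : SideLabel component
      label = record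
        { label-φ = φ-closure (λ d → component (φ d) ≡ component d)
            (λ d r → sym (component-edge (proj₁ (face-∈ d r))) , sym (component-edge (proj₂ (face-∈ d r))))
            (λ d p q → trans (cong component (face3 d)) (sym (trans q p)))
        ; label-α = α-closure (λ d → component (α d) ≡ component d)
            (λ d c → sym (component-edge (cross-∈ d c)))
            (λ d p → trans (cong component (α-invol d)) (sym p))
        }
      open SideLabel label
      open Reversed.SideLabel (reverse-label label) using () renaming (label-g to label-h)
      two-values : ∀ i → i ≡ component (g v₀) ⊎ i ≡ component (h v₀)
      two-values i with d , refl ← component-surjective i with exit d
      ... | inj₁ w = inj₂ (trans (sym (walk-preserves component label-σ w)) (label-h _ _))
      ... | inj₂ w = inj₁ (trans (sym (walk-preserves component label-σ w)) (label-g _ _))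
      two≤c : 2 ≤ components
      two≤c = +-cancelʳ-≤ (length edges) _ _
        (≤-trans (≤-reflexive (+-comm 2 _)) (≤-trans edges-count count))
      c≤2 : components ≤ 2
      c≤2 = two-valued⇒≤2 (component (g v₀)) (component (h v₀)) two-values
      flat₁ : ∀ {x y t} → (x , y , t) ∈ edges → value y ≡ transport t (value x)
      flat₁ with flat
      ... | inj₁ f = f
      ... | inj₂ m< = ⊥-elim (<-irrefl refl (≤-trans m< (≤-trans (+-monoˡ-≤ (length edges) c≤2)
              (≤-trans (≤-reflexive (+-comm 2 (length edges))) edges-count))))

    -- The ears are the vertices with a single triangle on their side of the cycle.
    ear? : ∀ v → Dec (σ (h v) ≡ g v)
    ear? v = σ (h v) ≟ g v

    ears : ℕ
    ears = sum (λ v → 𝟙 (ear? v))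

    module Dominate (F : Framing) where
      open Framing F
      open SideLabel sideLabel

      colour : Fin n → Fin 4
      colour v = proj₁ (frame (g v))

      -- For an ear this is the colour missing from its only triangle.
      fourth : Fin n → Fin 4
      fourth v = let t , i = frame (σ (h v)) in t ⊕ ω^ (turn (turn i))

      tail-colour-σ : ∀ y → ¬ OnCycle y → proj₁ (frame (σ y)) ≡ proj₁ (frame y)
      tail-colour-σ y ¬on = begin
        proj₁ (frame (σ y))                                ≡⟨ cong (proj₁ ∘ frame) (φα y) ⟨
        proj₁ (frame (φ (α y)))                            ≡⟨ cong proj₁ (frame-φ (α y)) ⟩
        proj₁ (transport along (frame (α y)))              ≡⟨ cong (proj₁ ∘ transport along) (frame-α y ¬on) ⟩
        -- `along` and `across` have the same first component, so the outer step may be read as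
        -- `across`.
        proj₁ (transport across (transport across (frame y))) ≡⟨ cong proj₁ (across² (frame y)) ⟩
        proj₁ (frame y)                                    ∎
        where open ≡-Reasoning

      Inside : Fin m → Set
      Inside d = ∀ v → side d ≡ side (g v)

      inside-φ : ∀ {d} → Inside d → Inside (φ d)
      inside-φ in-d v = trans (label-φ _) (in-d v)

      -- The walk out of `d` cannot end at `h`, which is on the other side; it ends at `g (tail d)`,
      -- and the tail colour is constant on the way.
      colour-tail : ∀ d → Inside d → colour (tail d) ≡ proj₁ (frame d)
      colour-tail d in-d with exit d
      ... | inj₁ w = ⊥-elim (sides≢ (tail d) (tail d)
              (trans (sym (in-d (tail d))) (sym (walk-preserves side label-σ w))))
      ... | inj₂ w = walk-preserves (proj₁ ∘ frame) tail-colour-σ w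

      class : Fin 4 → List (Fin n)
      class c = filter (λ v → colour v ≟ c) (allFin n) ++
                filter (λ v → fourth v ≟ c) (filter ear? (allFin n))

      colour-∈ : ∀ v → v ∈ class (colour v)
      colour-∈ v = ∈-++⁺ˡ (∈-filter⁺ (λ u → colour u ≟ colour v) (∈-allFin v) refl)

      ear-∈ : ∀ v → σ (h v) ≡ g v → v ∈ class (fourth v)
      ear-∈ v e = ∈-++⁺ʳ _ (∈-filter⁺ (λ u → fourth u ≟ fourth v) (∈-filter⁺ ear? (∈-allFin v) e) refl)

      -- The triangle of `σ (h v)` shows three colours on `v` and two of its neighbours. The fourth
      -- is found on the neighbour opposite, in the triangle across the dart `σ (h v)`.
      class-dominating : ∀ c → Dominating G (class c)
      class-dominating c v = go (four-colours (proj₁ (frame y)) (proj₂ (frame y)) c)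
        where
        y : Fin m
        y = σ (h v)
        tail-y : tail y ≡ v
        tail-y = trans (σ-tail (h v)) (tail-h v)
        in-y : Inside y
        in-y u = trans (sym (label-fan v)) (label-g v u)
        neighbour : ∀ {c} d → Inside d → tail (α d) ≡ v ⊎ Adj G (tail d) v → c ≡ proj₁ (frame d) →
          v ∈ class c ⊎ ∃[ u ] (u ∈ class c × Adj G u v)
        neighbour d in-d adj refl = inj₂ (tail d , subst (λ c → tail d ∈ class c) (colour-tail d in-d) (colour-∈ (tail d)) ,
          [ (λ p → d , refl , p) , (λ a → a) ]′ adj)
        go : _ → v ∈ class c ⊎ ∃[ u ] (u ∈ class c × Adj G u v)
        go (inj₁ (inj₁ refl)) = inj₁ (subst (λ c → v ∈ class c)
          (trans (cong colour (sym tail-y)) (colour-tail y in-y)) (colour-∈ v))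
        go (inj₁ (inj₂ refl)) = neighbour (φ y) (inside-φ in-y)
          (inj₂ (α y , sym (tail-φ y) , trans (cong tail (α-invol y)) tail-y))
          (sym (cong proj₁ (frame-φ y)))
        go (inj₂ (inj₁ refl)) = neighbour (φ (φ y)) (inside-φ (inside-φ in-y))
          (inj₁ (trans (tail-α-φφ y) tail-y))
          (sym (trans (cong proj₁ (trans (frame-φ (φ y)) (cong (transport along) (frame-φ y))))
            (third (proj₁ (frame y)) (proj₂ (frame y)))))
          where
          third : ∀ t i → (t ⊕ ω^ i) ⊕ ω^ (turn (turn i)) ≡ t ⊕ ω^ (turn i)
          third = toWitness {a? = all? λ t → all? λ i → (t ⊕ ω^ i) ⊕ ω^ (turn (turn i)) ≟ t ⊕ ω^ (turn i)} _
        -- If `y` is already `g v`, the triangle is the only one at `v` on this side, so `v` is an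
        -- ear that misses `c` and was added to the class.
        go (inj₂ (inj₂ refl)) with walk-start (fan v)
        ... | inj₁ e = inj₁ (ear-∈ v e)
        ... | inj₂ ¬on = neighbour (φ (φ (α y))) (inside-φ (inside-φ (λ u → trans (label-α y ¬on) (in-y u))))
          (inj₂ (subst (λ d → Adj G (tail (φ d)) v) (sym (φα y))
            (α (σ y) , sym (tail-φ (σ y)) , trans (cong tail (α-invol (σ y))) (trans (σ-tail y) tail-y))))
          (sym (trans (cong proj₁ (trans (frame-φ (φ (α y))) (cong (transport along) (trans (frame-φ (α y))
                 (cong (transport along) (frame-α y ¬on))))))
            (opposite (proj₁ (frame y)) (proj₂ (frame y)))))
          where
          opposite : ∀ t i → ((t ⊕ ω^ i) ⊕ ω^ i) ⊕ ω^ (turn (turn i)) ≡ t ⊕ ω^ (turn (turn i))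
          opposite = toWitness {a? = all? λ t → all? λ i →
            ((t ⊕ ω^ i) ⊕ ω^ i) ⊕ ω^ (turn (turn i)) ≟ t ⊕ ω^ (turn (turn i))} _

      classes-total : sum (λ c → length (class c)) ≡ n + ears
      classes-total = begin
        sum (λ c → length (class c))
          ≡⟨ sum-cong-≗ (λ c → length-++ (filter (λ v → colour v ≟ c) (allFin n))
               {filter (λ v → fourth v ≟ c) (filter ear? (allFin n))}) ⟩
        sum (λ c → size colour (allFin n) c + size fourth (filter ear? (allFin n)) c)
          ≡⟨ ∑-distrib-+ (size colour (allFin n)) (size fourth (filter ear? (allFin n))) ⟩
        sum (size colour (allFin n)) + sum (size fourth (filter ear? (allFin n)))
          ≡⟨ cong₂ _+_ (sum-colour-classes colour (allFin n)) (sum-colour-classes fourth (filter ear? (allFin n))) ⟩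
        length (allFin n) + length (filter ear? (allFin n))
          ≡⟨ cong₂ _+_ (length-tabulate {n = n} (λ x → x)) (length-filter-tabulate ear? (λ x → x)) ⟩
        n + ears ∎
        where
        open ≡-Reasoning
        size : (Fin n → Fin 4) → List (Fin n) → Fin 4 → ℕ
        size f xs c = length (filter (λ v → f v ≟ c) xs)

    chord : ∀ v → σ (h v) ≡ g v → Adj G (prv v) (nxt v)
    chord v ear = φ (g v) , trans (tail-φ (g v)) (trans (cong tail (α-g v)) (tail-h (prv v))) , (begin
      tail (α (φ (g v))) ≡⟨ tail-φ (φ (g v)) ⟨
      tail (φ (φ (g v))) ≡⟨ cong tail (α-invol _) ⟨
      -- `σ` sends both `α (φ (φ (g v)))` and `h v` to `g v`.
      tail (α (α (φ (φ (g v))))) ≡⟨ cong (tail ∘ α) (σ-inj (trans (face3 (g v)) (sym ear))) ⟩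
      tail (α (h v))     ≡⟨ cong tail (α-h v) ⟩
      tail (g (nxt v))   ≡⟨ tail-g (nxt v) ⟩
      nxt v              ∎)
      where open ≡-Reasoning

    -- The rotation at such a vertex would alternate between `h v` and `g v`, leaving two
    -- neighbours, and three of the given ones could not be distinct.
    ears-disjoint : MinDegreeAtLeast G 4 → ∀ v → σ (h v) ≡ g v → σ (g v) ≡ h v → ⊥
    ears-disjoint degree v σh≡g σg≡h with f , f-inj , adj ← degree v =
      go (neighbour (adj 0F)) (neighbour (adj 1F)) (neighbour (adj 2F))
      where
      darts : ∀ k → iter σ k (h v) ≡ h v ⊎ iter σ k (h v) ≡ g v
      darts zero = inj₁ refl
      darts (suc k) with darts k
      ... | inj₁ eq = inj₂ (trans (cong σ eq) σh≡g)
      ... | inj₂ eq = inj₁ (trans (cong σ eq) σg≡h)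
      neighbour : ∀ {u} → Adj G v u → u ≡ nxt v ⊎ u ≡ prv v
      neighbour (d , tail-d , refl) with k , refl ← σ-orbit (h v) d (trans (tail-h v) (sym tail-d)) with darts k
      ... | inj₁ eq = inj₁ (trans (cong (tail ∘ α) eq) (trans (cong tail (α-h v)) (tail-g _)))
      ... | inj₂ eq = inj₂ (trans (cong (tail ∘ α) eq) (trans (cong tail (α-g v)) (tail-h _)))
      clash : ∀ {i j w} → i ≢ j → f i ≡ w → f j ≡ w → ⊥
      clash i≢j p q = i≢j (f-inj (trans p (sym q)))
      go : f 0F ≡ nxt v ⊎ f 0F ≡ prv v → f 1F ≡ nxt v ⊎ f 1F ≡ prv v → f 2F ≡ nxt v ⊎ f 2F ≡ prv v → ⊥
      go (inj₁ p) (inj₁ q) _ = clash (λ ()) p q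
      go (inj₂ p) (inj₂ q) _ = clash (λ ()) p q
      go (inj₁ p) (inj₂ q) (inj₁ r) = clash (λ ()) p r
      go (inj₁ p) (inj₂ q) (inj₂ r) = clash (λ ()) q r
      go (inj₂ p) (inj₁ q) (inj₁ r) = clash (λ ()) q r
      go (inj₂ p) (inj₁ q) (inj₂ r) = clash (λ ()) p r

    small-dominating-class : Fin n → ∃[ D ] (Dominating G D × 4 * length D ≤ n + ears)
    small-dominating-class v₀ =
      let c , small = smallest-term (λ c → length (class c)) in
      class c , class-dominating c , ≤-trans small (≤-reflexive classes-total)
      where open Dominate (framing v₀)

-- Finite injections and sums over consecutive positions.

injective⇒onto : ∀ {n} (f : Fin n → Fin n) → Injective _≡_ _≡_ f → ∀ v → ∃[ i ] f i ≡ v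
injective⇒onto {suc n} f f-inj v with any? (λ i → f i ≟ v)
... | yes hit = hit
... | no miss = ⊥-elim (<-irrefl refl (injective⇒≤ {f = λ i → punchOut (v≢f i)}
        λ {i} {j} eq → f-inj (punchOut-injective (v≢f i) (v≢f j) eq)))
  where
  v≢f : ∀ i → v ≢ f i
  v≢f i eq = miss (i , sym eq)

range : (ℕ → ℕ) → ℕ → ℕ → ℕ
range F p zero = 0
range F p (suc r) = F p + range F (suc p) r

range-split : ∀ F p r s → range F p (r + s) ≡ range F p r + range F (r + p) s
range-split F p zero s = refl
range-split F p (suc r) s rewrite sym (+-suc r p) =
  trans (cong (F p +_) (range-split F (suc p) r s)) (sym (+-assoc (F p) _ _))

range-last : ∀ F p r → range F p (suc r) ≡ range F p r + F (r + p)
range-last F p r = begin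
  range F p (suc r)               ≡⟨ cong (range F p) (+-comm r 1) ⟨
  range F p (r + 1)               ≡⟨ range-split F p r 1 ⟩
  range F p r + (F (r + p) + 0)   ≡⟨ cong (range F p r +_) (+-identityʳ _) ⟩
  range F p r + F (r + p)         ∎
  where open ≡-Reasoning

sum-toℕ : ∀ F p r → sum {r} (λ i → F (toℕ i + p)) ≡ range F p r
sum-toℕ F p zero = refl
sum-toℕ F p (suc r) = cong (F p +_) (trans (sum-cong-≗ {r} λ i → cong F (sym (+-suc (toℕ i) p))) (sum-toℕ F (suc p) r))

range-const : ∀ c p r → range (λ _ → c) p r ≡ r * c
range-const c p zero = refl
range-const c p (suc r) = cong (c +_) (range-const c (suc p) r)

-- Moving the start by one drops `F p` and adds `F (n + p)`, which is equal to it.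
range-periodic : ∀ F n → (∀ k → F (k + n) ≡ F k) → ∀ p → range F p n ≡ range F 0 n
range-periodic F n period zero = refl
range-periodic F n period (suc p) = trans (+-cancelˡ-≡ (F p) _ _ (begin
  F p + range F (suc p) n   ≡⟨ range-last F p n ⟩
  range F p n + F (n + p)   ≡⟨ cong (range F p n +_) (trans (cong F (+-comm n p)) (period p)) ⟩
  range F p n + F p         ≡⟨ +-comm _ (F p) ⟩
  F p + range F p n         ∎)) (range-periodic F n period p)
  where open ≡-Reasoning

-- Arithmetic of the bound.

bound≥2n/7 : ∀ n → 2 * n ≤ 7 * bound n
bound≥2n/7 n = ≤-trans (+-cancelˡ-≤ 6 _ _ (begin
  6 + 2 * n                                    ≡⟨ +-comm 6 (2 * n) ⟩
  2 * n + 6                                    ≡⟨ m≡m%n+[m/n]*n (2 * n + 6) 7 ⟩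
  (2 * n + 6) % 7 + (2 * n + 6) / 7 * 7        ≤⟨ +-monoˡ-≤ _ (≤-pred (m%n<n (2 * n + 6) 7)) ⟩
  6 + (2 * n + 6) / 7 * 7                      ≡⟨ cong (6 +_) (*-comm ((2 * n + 6) / 7) 7) ⟩
  6 + 7 * ((2 * n + 6) / 7)                    ∎))
  (*-monoʳ-≤ 7 (m≤m⊔n ((2 * n + 6) / 7) (5 * n / 16)))
  where open ≤-Reasoning

bound≥5n/16 : ∀ n → 5 * n ≤ 15 + 16 * bound n
bound≥5n/16 n = begin
  5 * n                             ≡⟨ m≡m%n+[m/n]*n (5 * n) 16 ⟩
  5 * n % 16 + 5 * n / 16 * 16      ≤⟨ +-mono-≤ (≤-pred (m%n<n (5 * n) 16)) (≤-reflexive (*-comm (5 * n / 16) 16)) ⟩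
  15 + 16 * (5 * n / 16)            ≤⟨ +-monoʳ-≤ 15 (*-monoʳ-≤ 16 (m≤n⊔m ((2 * n + 6) / 7) (5 * n / 16))) ⟩
  15 + 16 * bound n                 ∎
  where open ≤-Reasoning

-- If `B < x`, then 4B ≤ n, so 8n ≤ 28B ≤ 7n, impossible for positive n.
dense-small : ∀ n B x → 1 ≤ n → 2 * n ≤ 7 * B → 4 * x ≤ n + 3 → x ≤ B
dense-small n B x 1≤n 2n≤7B 4x≤ = ≮⇒≥ λ B<x → <-irrefl refl (begin-strict
  8 * n         ≡⟨ *-assoc 4 2 n ⟩
  4 * (2 * n)   ≤⟨ *-monoʳ-≤ 4 2n≤7B ⟩
  4 * (7 * B)   ≡⟨ e₁ B ⟩
  7 * (4 * B)   ≤⟨ *-monoʳ-≤ 7 (+-cancelʳ-≤ 3 _ _ (begin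
    4 * B + 3     ≤⟨ n≤1+n _ ⟩
    suc (4 * B + 3) ≡⟨ e₂ B ⟩
    4 * suc B     ≤⟨ *-monoʳ-≤ 4 B<x ⟩
    4 * x         ≤⟨ 4x≤ ⟩
    n + 3         ∎)) ⟩
  7 * n         <⟨ m<n+m (7 * n) 1≤n ⟩
  8 * n         ∎)
  where
  open ≤-Reasoning
  e₁ : ∀ B → 4 * (7 * B) ≡ 7 * (4 * B)
  e₁ = solve-∀
  e₂ : ∀ B → suc (4 * B + 3) ≡ 4 * suc B
  e₂ = solve-∀
-- The bounds 2n ≤ 7B, 5n ≤ 15 + 16B and 13(B + 1) ≤ 4n + 2 are contradictory:
-- combine them with multipliers 1, 2, 3.
sparse-small : ∀ n B a b x y z → 2 * n ≤ 7 * B → 5 * n ≤ 15 + 16 * B → B < y → B < z →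
  4 * y ≤ n + a → 4 * z ≤ n + b → 5 * x + a + b ≤ 2 * n + 2 → x ≤ B
sparse-small n B a b x y z 2n≤7B 5n≤16B B<y B<z y≤ z≤ x≤ = ≮⇒≥ λ B<x → <-irrefl refl (begin-strict
  39 * B + 36                               <⟨ +-monoʳ-< (39 * B) (m<n+m 36 {3} (s≤s z≤n)) ⟩
  39 * B + 39                               ≡⟨ e₁ B ⟩
  3 * (13 * suc B)                          ≤⟨ *-monoʳ-≤ 3 (thirteen B<x) ⟩
  3 * (4 * n + 2)                           ≡⟨ e₂ n ⟩
  2 * n + 2 * (5 * n) + 6                   ≤⟨ +-monoˡ-≤ 6 (+-mono-≤ 2n≤7B (*-monoʳ-≤ 2 5n≤16B)) ⟩
  7 * B + 2 * (15 + 16 * B) + 6             ≡⟨ e₃ B ⟩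
  39 * B + 36                               ∎)
  where
  open ≤-Reasoning
  e₁ : ∀ B → 39 * B + 39 ≡ 3 * (13 * suc B)
  e₁ = solve-∀
  e₂ : ∀ n → 3 * (4 * n + 2) ≡ 2 * n + 2 * (5 * n) + 6
  e₂ = solve-∀
  e₃ : ∀ B → 7 * B + 2 * (15 + 16 * B) + 6 ≡ 39 * B + 36
  e₃ = solve-∀
  e₄ : ∀ B a b → 13 * suc B + (a + b) ≡ 5 * suc B + a + b + (4 * suc B + 4 * suc B)
  e₄ = solve-∀
  e₅ : ∀ n a b → 2 * n + 2 + (n + a + (n + b)) ≡ 4 * n + 2 + (a + b)
  e₅ = solve-∀
  -- All three sizes are at least B + 1; adding the three size inequalities makes `a` and `b`
  -- cancel.
  thirteen : B < x → 13 * suc B ≤ 4 * n + 2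
  thirteen B<x = +-cancelʳ-≤ (a + b) _ _ (begin
    13 * suc B + (a + b)
      ≡⟨ e₄ B a b ⟩
    5 * suc B + a + b + (4 * suc B + 4 * suc B)
      ≤⟨ +-mono-≤ (+-monoˡ-≤ b (+-monoˡ-≤ a (*-monoʳ-≤ 5 B<x))) (+-mono-≤ (*-monoʳ-≤ 4 B<y) (*-monoʳ-≤ 4 B<z)) ⟩
    5 * x + a + b + (4 * y + 4 * z)
      ≤⟨ +-mono-≤ x≤ (+-mono-≤ y≤ z≤) ⟩
    2 * n + 2 + (n + a + (n + b))
      ≡⟨ e₅ n a b ⟩
    4 * n + 2 + (a + b) ∎)

-- Greedy covering of consecutive positions.

module Greedy {n : ℕ} (G : PlaneTriangulation n) (w : ℕ → Fin n) where

  Dominated : List (Fin n) → Fin n → Set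
  Dominated D v = v ∈ D ⊎ ∃[ u ] (u ∈ D × Adj G u v)

  Covers : List (Fin n) → ℕ → ℕ → Set
  Covers D p r = ∀ i → i < r → Dominated D (w (i + p))

  -- A run of positions from `p` on that one vertex dominates. Storing the length less one makes it
  -- nonempty, so the greedy procedure advances.
  record Window (F : ℕ → ℕ) (c p : ℕ) : Set where
    field
      centre : Fin n
      extent : ℕ
      reaches : ∀ i → i < suc extent → w (i + p) ≡ centre ⊎ Adj G centre (w (i + p))
      weight : c ≤ range F p (suc extent)

  -- All vertices of `D` but the last account for weight `c` each, and the last serves a run that
  -- contains the final position; so c(|D| - 1) plus the weight of that position is at most the
  -- total.
  Cover : (F : ℕ → ℕ) (c : ℕ) → ℕ → ℕ → Set
  Cover F c r p = ∃[ D ] (Covers D p (suc r) × c * length D + F (r + p) ≤ range F p (suc r) + c)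

  -- The first window has its own weight `a`, so that a heavier start can be exploited. If it
  -- reaches the end its centre suffices, whence the alternative `length D ≤ 1`.
  extend : ∀ F c a r p → Window F a p → (∀ s q → s < r → Cover F c s q) →
    ∃[ D ] (Covers D p (suc r) × (length D ≤ 1 ⊎ a + c * length D + F (r + p) ≤ range F p (suc r) + (c + c)))
  extend F c a r p win rest with ≤-<-connex r (Window.extent win)
  ... | inj₁ r≤ = Window.centre win ∷ [] , (λ i i<r → single (reaches i (≤-trans i<r (s≤s r≤)))) , inj₁ ≤-refl
    where
    open Window win
    single : ∀ {v} → v ≡ centre ⊎ Adj G centre v → Dominated (centre ∷ []) v
    single (inj₁ refl) = inj₁ (here refl)
    single (inj₂ adj) = inj₂ (centre , here refl , adj)
  -- With `r = suc ℓ + s` the window takes `suc ℓ` of the `suc r` positions, and `suc s` of them, at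
  -- least one, remain.
  ... | inj₂ ℓ<r with s , refl ← m≤n⇒∃[o]m+o≡n ℓ<r
    with D , covers , small ← rest s (suc (Window.extent win) + p) (s≤s (m≤n+m s _)) =
    centre ∷ D , covers′ , inj₂ (begin
      a + c * suc (length D) + F (suc ℓ + s + p)
        ≡⟨ cong₂ (λ x y → a + x + F y) (*-suc c (length D)) shift ⟩
      a + (c + c * length D) + F (s + (suc ℓ + p))
        ≡⟨ regroup a c (c * length D) _ ⟩
      a + (c * length D + F (s + (suc ℓ + p))) + c
        ≤⟨ +-monoˡ-≤ c (+-mono-≤ weight small) ⟩
      range F p (suc ℓ) + (range F (suc ℓ + p) (suc s) + c) + c
        ≡⟨ regroup′ (range F p (suc ℓ)) _ c ⟩
      range F p (suc ℓ) + range F (suc ℓ + p) (suc s) + (c + c)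
        ≡⟨ cong (_+ (c + c)) (range-split F p (suc ℓ) (suc s)) ⟨
      range F p (suc ℓ + suc s) + (c + c)
        ≡⟨ cong (λ x → range F p x + (c + c)) (+-suc (suc ℓ) s) ⟩
      range F p (suc (suc ℓ + s)) + (c + c) ∎)
    where
    open ≤-Reasoning
    open Window win renaming (extent to ℓ)
    regroup : ∀ a c x y → a + (c + x) + y ≡ a + (x + y) + c
    regroup = solve-∀
    regroup′ : ∀ a x c → a + (x + c) + c ≡ a + x + (c + c)
    regroup′ = solve-∀
    shift : suc ℓ + s + p ≡ s + (suc ℓ + p)
    shift = trans (cong (_+ p) (+-comm (suc ℓ) s)) (+-assoc s (suc ℓ) p)
    weaken : ∀ {v} → Dominated D v → Dominated (centre ∷ D) v
    weaken (inj₁ v∈) = inj₁ (there v∈)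
    weaken (inj₂ (u , u∈ , adj)) = inj₂ (u , there u∈ , adj)
    covers′ : Covers (centre ∷ D) p (suc (suc ℓ + s))
    covers′ i i< with ≤-<-connex (suc ℓ) i
    ... | inj₂ i<ℓ with reaches i i<ℓ
    ...   | inj₁ eq = inj₁ (here eq)
    ...   | inj₂ adj = inj₂ (centre , here refl , adj)
    covers′ i i< | inj₁ ℓ≤i with j , refl ← m≤n⇒∃[o]m+o≡n ℓ≤i =
      subst (Dominated (centre ∷ D) ∘ w)
        (sym (trans (cong (_+ p) (+-comm (suc ℓ) j)) (+-assoc j (suc ℓ) p)))
        (weaken (covers j (+-cancelˡ-≤ (suc ℓ) _ _ (≤-trans (≤-reflexive (+-suc (suc ℓ) j))
          (≤-trans i< (≤-reflexive (sym (+-suc (suc ℓ) s))))))))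

  greedy : ∀ F c → (∀ p → Window F c p) → ∀ r p → Cover F c r p
  greedy F c windows = <-rec (λ r → ∀ p → Cover F c r p) λ r rec p → finish r p
    (extend F c c r p (windows p) λ s q s<r → rec s<r q)
    where
    open ≤-Reasoning
    finish : ∀ r p → _ → Cover F c r p
    finish r p (D , covers , inj₂ small) = D , covers , +-cancelˡ-≤ c _ _ (begin
      c + (c * length D + F (r + p)) ≡⟨ +-assoc c _ _ ⟨
      c + c * length D + F (r + p)   ≤⟨ small ⟩
      range F p (suc r) + (c + c)    ≡⟨ +-assoc _ c c ⟨
      range F p (suc r) + c + c      ≡⟨ +-comm _ c ⟩
      c + (range F p (suc r) + c)    ∎)
    finish r p (D , covers , inj₁ single) = D , covers , (begin
      c * length D + F (r + p)             ≤⟨ +-mono-≤ (*-monoʳ-≤ c single) (m≤n+m _ (range F p r)) ⟩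
      c * 1 + (range F p r + F (r + p))    ≡⟨ cong₂ _+_ (*-identityʳ c) (sym (range-last F p r)) ⟩
      c + range F p (suc r)                ≡⟨ +-comm c _ ⟩
      range F p (suc r) + c                ∎)

-- Ears along the cycle and the choice of a small dominating set.

-- Ears weigh 1 and other vertices 2. As no vertex is an ear on both sides, the total weight is at
-- most 2n - t - t′.
cost : {A : Set} → Dec A → ℕ
cost (yes _) = 1
cost (no _) = 2

1≤cost : {A : Set} (A? : Dec A) → 1 ≤ cost A?
1≤cost (yes _) = ≤-refl
1≤cost (no _) = s≤s z≤n

cost-no : {A : Set} (A? : Dec A) → ¬ A → cost A? ≡ 2
cost-no (yes a) ¬a = ⊥-elim (¬a a)
cost-no (no _) _ = refl

cost-⊎ : {A B : Set} (A? : Dec A) (B? : Dec B) → (A → B → ⊥) → cost (A? ⊎-dec B?) + 𝟙 A? + 𝟙 B? ≤ 2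
cost-⊎ (yes a) (yes b) disjoint = ⊥-elim (disjoint a b)
cost-⊎ (yes _) (no _) _ = ≤-refl
cost-⊎ (no _) (yes _) _ = ≤-refl
cost-⊎ (no _) (no _) _ = ≤-refl

module Positions {N : ℕ} (G : PlaneTriangulation (suc N)) (degree : MinDegreeAtLeast G 4) (C : Cycle G)
  (w : ℕ → Fin (suc N)) (nxt-w : ∀ k → Cycle.nxt C (w k) ≡ w (suc k)) (w-period : ∀ k → w (k + suc N) ≡ w k)
  (w-onto : ∀ p v → ∃[ i ] (i < suc N × w (i + p) ≡ v))
  (w-sum : ∀ f → range (f ∘ w) 0 (suc N) ≡ sum f)
  where
  open PlaneTriangulation G
  open Cycle C

  n : ℕ
  n = suc N

  open Colour G C using (ears; ear?; small-dominating-class; chord; ears-disjoint)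
  open Colour G (reverse G C) using () renaming
    (ears to ears′; ear? to ear′?; small-dominating-class to small-dominating-class′; chord to chord′)
  open Greedy G w

  Ear : Fin n → Set
  Ear v = σ (h v) ≡ g v ⊎ σ (g v) ≡ h v

  eitherEar? : Decidable Ear
  eitherEar? v = ear? v ⊎-dec ear′? v

  adj-w : ∀ k → Adj G (w k) (w (suc k))
  adj-w k = subst (Adj G (w k)) (nxt-w k) (adj-nxt (w k))

  back-w : ∀ k → Adj G (w (suc k)) (w k)
  back-w k = adj-sym G (adj-w k)

  ear-adj : ∀ k → Ear (w (suc k)) → Adj G (w k) (w (suc (suc k)))
  ear-adj k ear = subst₂ (Adj G) (trans (cong prv (sym (nxt-w k))) (prv-nxt (w k))) (nxt-w (suc k)) (either ear)
    where
    either : Ear (w (suc k)) → Adj G (prv (w (suc k))) (nxt (w (suc k)))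
    either (inj₁ e) = chord _ e
    either (inj₂ e) = adj-sym G (chord′ _ e)

  F : ℕ → ℕ
  F k = cost (eitherEar? (w k))

  1≤F : ∀ k → 1 ≤ F k
  1≤F k = 1≤cost (eitherEar? (w k))

  window₃ : ∀ {F c p} → c ≤ range F p 3 → Window F c p
  window₃ {p = p} c≤ = record { centre = w (1 + p) ; extent = 2 ; weight = c≤ ; reaches = λ
    { 0 _ → inj₂ (back-w p) ; 1 _ → inj₁ refl ; 2 _ → inj₂ (adj-w (1 + p))
    ; (suc (suc (suc _))) (s≤s (s≤s (s≤s ()))) } }

  -- The chord over an ear lets the cycle neighbour chosen as centre reach one position beyond the
  -- ear, backwards in the first case and forwards in the second.
  window₄ : ∀ {F c p} → Ear (w (1 + p)) ⊎ Ear (w (2 + p)) → c ≤ range F p 4 → Window F c p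
  window₄ {p = p} (inj₁ ear) c≤ = record { centre = w (2 + p) ; extent = 3 ; weight = c≤ ; reaches = λ
    { 0 _ → inj₂ (adj-sym G (ear-adj p ear)) ; 1 _ → inj₂ (back-w (1 + p))
    ; 2 _ → inj₁ refl ; 3 _ → inj₂ (adj-w (2 + p))
    ; (suc (suc (suc (suc _)))) (s≤s (s≤s (s≤s (s≤s ())))) } }
  window₄ {p = p} (inj₂ ear) c≤ = record { centre = w (1 + p) ; extent = 3 ; weight = c≤ ; reaches = λ
    { 0 _ → inj₂ (back-w p) ; 1 _ → inj₁ refl ; 2 _ → inj₂ (adj-w (1 + p)) ; 3 _ → inj₂ (ear-adj (1 + p) ear)
    ; (suc (suc (suc (suc _)))) (s≤s (s≤s (s≤s (s≤s ())))) } }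

  window₅ : ∀ {F c p} → Ear (w (1 + p)) → Ear (w (3 + p)) → c ≤ range F p 5 → Window F c p
  window₅ {p = p} ear₁ ear₃ c≤ = record { centre = w (2 + p) ; extent = 4 ; weight = c≤ ; reaches = λ
    { 0 _ → inj₂ (adj-sym G (ear-adj p ear₁)) ; 1 _ → inj₂ (back-w (1 + p))
    ; 2 _ → inj₁ refl ; 3 _ → inj₂ (adj-w (2 + p)) ; 4 _ → inj₂ (ear-adj (2 + p) ear₃)
    ; (suc (suc (suc (suc (suc _))))) (s≤s (s≤s (s≤s (s≤s (s≤s ()))))) } }

  -- Fewer ears shorten the window but make its positions heavier: after `p` the weights are at
  -- least 1+1+1+1, 1+1+2, 2+1+1 or 2+2. The weight of `p` is kept apart because it may be 2.
  window : ∀ p → Window F (F p + 4) p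
  window p = choose (eitherEar? (w (1 + p))) (eitherEar? (w (2 + p))) (eitherEar? (w (3 + p)))
    where
    two : ∀ k → ¬ Ear (w k) → 2 ≤ F k
    two k ¬e = ≤-reflexive (sym (cost-no (eitherEar? (w k)) ¬e))
    choose : Dec (Ear (w (1 + p))) → Dec (Ear (w (2 + p))) → Dec (Ear (w (3 + p))) → Window F (F p + 4) p
    choose (yes e₁) _ (yes e₃) = window₅ e₁ e₃ (+-monoʳ-≤ (F p)
      (+-mono-≤ (1≤F (1 + p)) (+-mono-≤ (1≤F (2 + p)) (+-mono-≤ (1≤F (3 + p)) (+-mono-≤ (1≤F (4 + p)) z≤n)))))
    choose (yes e₁) _ (no ¬e₃) = window₄ (inj₁ e₁) (+-monoʳ-≤ (F p)
      (+-mono-≤ (1≤F (1 + p)) (+-mono-≤ (1≤F (2 + p)) (+-mono-≤ (two (3 + p) ¬e₃) z≤n))))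
    choose (no ¬e₁) (yes e₂) _ = window₄ (inj₂ e₂) (+-monoʳ-≤ (F p)
      (+-mono-≤ (two (1 + p) ¬e₁) (+-mono-≤ (1≤F (2 + p)) (+-mono-≤ (1≤F (3 + p)) z≤n))))
    choose (no ¬e₁) (no ¬e₂) _ = window₃ (+-monoʳ-≤ (F p)
      (+-mono-≤ (two (1 + p) ¬e₁) (+-mono-≤ (two (2 + p) ¬e₂) z≤n)))

  covers⇒dominating : ∀ D p → Covers D p n → Dominating G D
  covers⇒dominating D p covers v = let i , i<n , at-v = w-onto p v in subst (Dominated D) at-v (covers i i<n)

  total : ∀ p → range F p n + ears + ears′ ≤ 2 * n
  total p = begin
    range F p n + ears + ears′
      ≡⟨ cong (λ x → x + ears + ears′) (range-periodic F n (λ k → cong (λ v → cost (eitherEar? v)) (w-period k)) p) ⟩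
    range F 0 n + ears + ears′
      ≡⟨ cong (λ x → x + ears + ears′) (w-sum (λ v → cost (eitherEar? v))) ⟩
    sum (λ v → cost (eitherEar? v)) + ears + ears′
      ≡⟨ trans (∑-distrib-+ (λ v → cost (eitherEar? v) + 𝟙 (ear? v)) (λ v → 𝟙 (ear′? v)))
           (cong (_+ ears′) (∑-distrib-+ (λ v → cost (eitherEar? v)) (λ v → 𝟙 (ear? v)))) ⟨
    sum (λ v → cost (eitherEar? v) + 𝟙 (ear? v) + 𝟙 (ear′? v))
      ≤⟨ sum-mono (λ v → cost-⊎ (ear? v) (ear′? v) (ears-disjoint degree v)) ⟩
    sum {n} (λ _ → 2)
      ≡⟨ trans (sum-const n 2) (*-comm n 2) ⟩
    2 * n ∎
    where
    open ≤-Reasoning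

  -- Starting at the second of two consecutive non-ears, the first window has one unit more than
  -- needed and the last position, the other non-ear, counts 2.
  sparse : ∃[ v ] (¬ Ear v × ¬ Ear (nxt v)) →
    ∃[ D ] (Dominating G D × (length D ≤ 1 ⊎ 5 * length D + ears + ears′ ≤ 2 * n + 2))
  sparse (v , ¬e , ¬e′) = result (extend F 5 6 N p first (λ r q _ → greedy F 5 windows r q))
    where
    k : ℕ
    k = proj₁ (w-onto 0 v)
    p : ℕ
    p = suc k
    w-k : w k ≡ v
    w-k = trans (cong w (sym (+-identityʳ k))) (proj₂ (proj₂ (w-onto 0 v)))
    cost-of : ∀ {k u} → w k ≡ u → ¬ Ear u → F k ≡ 2
    cost-of {k} refl ¬e = cost-no (eitherEar? (w k)) ¬e
    windows : ∀ q → Window F 5 q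
    windows q = record { Window (window q) ; weight = ≤-trans (+-monoˡ-≤ 4 (1≤F q)) (Window.weight (window q)) }
    first : Window F 6 p
    first = record { Window (window p) ; weight = ≤-trans
      (≤-reflexive (cong (_+ 4) (sym (cost-of (trans (sym (nxt-w k)) (cong nxt w-k)) ¬e′)))) (Window.weight (window p)) }
    -- Position `N + p` is one full turn after `k`, so it is `v` again.
    last : F (N + p) ≡ 2
    last = cost-of (trans (cong w (trans (+-comm N p) (sym (+-suc k N)))) (trans (w-period k) w-k)) ¬e
    result : _ → ∃[ D ] (Dominating G D × (length D ≤ 1 ⊎ 5 * length D + ears + ears′ ≤ 2 * n + 2))
    result (D , covers , inj₁ single) = D , covers⇒dominating D p covers , inj₁ single
    result (D , covers , inj₂ small) = D , covers⇒dominating D p covers , inj₂ (+-cancelˡ-≤ 8 _ _ (begin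
      8 + (5 * length D + ears + ears′)           ≡⟨ regroup (length D) ears ears′ ⟩
      6 + 5 * length D + 2 + ears + ears′         ≡⟨ cong (λ x → 6 + 5 * length D + x + ears + ears′) last ⟨
      6 + 5 * length D + F (N + p) + ears + ears′ ≤⟨ +-monoˡ-≤ ears′ (+-monoˡ-≤ ears small) ⟩
      range F p n + 10 + ears + ears′             ≡⟨ regroup′ (range F p n) ears ears′ ⟩
      range F p n + ears + ears′ + 10             ≤⟨ +-monoˡ-≤ 10 (total p) ⟩
      2 * n + 10                                  ≡⟨ regroup″ n ⟩
      8 + (2 * n + 2)                             ∎))
      where
      open ≤-Reasoning
      regroup : ∀ x a b → 8 + (5 * x + a + b) ≡ 6 + 5 * x + 2 + a + b
      regroup = solve-∀
      regroup′ : ∀ x a b → x + 10 + a + b ≡ x + a + b + 10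
      regroup′ = solve-∀
      regroup″ : ∀ x → 2 * x + 10 ≡ 8 + (2 * x + 2)
      regroup″ = solve-∀

  -- One of any two consecutive positions is an ear, so every window has four positions, now of
  -- weight 1 each. The slack 4 of `Cover`, less the weight of the final position, gives the 3.
  dense : ¬ (∃[ v ] (¬ Ear v × ¬ Ear (nxt v))) → ∃[ D ] (Dominating G D × 4 * length D ≤ n + 3)
  dense none = result (greedy (λ _ → 1) 4 windows N 0)
    where
    open ≤-Reasoning
    ear-near : ∀ p → Ear (w (1 + p)) ⊎ Ear (w (2 + p))
    ear-near p with eitherEar? (w (1 + p)) | eitherEar? (w (2 + p))
    ... | yes e | _ = inj₁ e
    ... | no _ | yes e = inj₂ e
    ... | no ¬e | no ¬e′ = ⊥-elim (none (w (1 + p) , ¬e , subst (¬_ ∘ Ear) (sym (nxt-w (1 + p))) ¬e′))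
    windows : ∀ p → Window (λ _ → 1) 4 p
    windows p = window₄ (ear-near p) ≤-refl
    result : Cover (λ _ → 1) 4 N 0 → ∃[ D ] (Dominating G D × 4 * length D ≤ n + 3)
    result (D , covers , small) = D , covers⇒dominating D 0 covers , +-cancelʳ-≤ 1 _ _ (begin
      4 * length D + 1              ≤⟨ small ⟩
      range (λ _ → 1) 0 n + 4       ≡⟨ cong (_+ 4) (trans (range-const 1 0 n) (*-identityʳ n)) ⟩
      n + 4                         ≡⟨ +-assoc n 3 1 ⟨
      n + 3 + 1                     ∎)

  -- If the colour classes of both sides exceed the bound, their sizes force many ears, and many
  -- ears make the set found along the cycle small.
  conclusion : DominationNumberAtMost G (bound n)
  conclusion = choose (small-dominating-class zero) (small-dominating-class′ zero)
    where
    B : ℕ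
    B = bound n
    1≤B : 1 ≤ B
    1≤B = *-cancelˡ-< 7 0 B (≤-trans (s≤s z≤n) (bound≥2n/7 n))
    choose : ∃[ D ] (Dominating G D × 4 * length D ≤ n + ears) →
      ∃[ D ] (Dominating G D × 4 * length D ≤ n + ears′) →
      DominationNumberAtMost G B
    choose (D₁ , dom₁ , small₁) (D₂ , dom₂ , small₂) = split (≤-<-connex (length D₁) B) (≤-<-connex (length D₂) B)
      (any? λ v → ¬? (eitherEar? v) ×-dec ¬? (eitherEar? (nxt v)))
      where
      finish : B < length D₁ → B < length D₂ →
        ∃[ D ] (Dominating G D × (length D ≤ 1 ⊎ 5 * length D + ears + ears′ ≤ 2 * n + 2)) → DominationNumberAtMost G B
      finish _ _ (D , dom , inj₁ single) = D , dom , ≤-trans single 1≤B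
      finish B<₁ B<₂ (D , dom , inj₂ small) = D , dom , sparse-small n B ears ears′ (length D) (length D₁) (length D₂)
        (bound≥2n/7 n) (bound≥5n/16 n) B<₁ B<₂ small₁ small₂ small
      split : length D₁ ≤ B ⊎ B < length D₁ → length D₂ ≤ B ⊎ B < length D₂ →
        Dec (∃[ v ] (¬ Ear v × ¬ Ear (nxt v))) → DominationNumberAtMost G B
      split (inj₁ ≤B) _ _ = D₁ , dom₁ , ≤B
      split (inj₂ _) (inj₁ ≤B) _ = D₂ , dom₂ , ≤B
      split (inj₂ B<₁) (inj₂ B<₂) (yes some) = finish B<₁ B<₂ (sparse some)
      split (inj₂ _) (inj₂ _) (no none) = let D , dom , small = dense none in
        D , dom , dense-small n B (length D) (s≤s z≤n) (bound≥2n/7 n) small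

-- From the given Hamilton cycle to a periodic sequence of vertices.

module Hamiltonian {N : ℕ} (G : PlaneTriangulation (suc N)) (2≤N : 2 ≤ N)
  (hc : Fin (suc N) → Fin (suc N)) (hc-inj : Injective _≡_ _≡_ hc)
  (hc-adj : ∀ i j → (suc (toℕ i) ≡ toℕ j ⊎ (suc (toℕ i) ≡ suc N × toℕ j ≡ 0)) → Adj G (hc i) (hc j))
  where
  open PlaneTriangulation G

  n : ℕ
  n = suc N

  w : ℕ → Fin n
  w k = hc (k mod n)

  toℕ-mod : ∀ k → toℕ (k mod n) ≡ k % n
  toℕ-mod k = toℕ-fromℕ< (m%n<n k n)

  w-cong : ∀ k l → k % n ≡ l % n → w k ≡ w l
  w-cong k l eq = cong hc (toℕ-injective (trans (toℕ-mod k) (trans eq (sym (toℕ-mod l)))))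

  w-reflects : ∀ k l → w k ≡ w l → k % n ≡ l % n
  w-reflects k l eq = trans (sym (toℕ-mod k)) (trans (cong toℕ (hc-inj eq)) (toℕ-mod l))

  +-cong-% : ∀ k l j → k % n ≡ l % n → (k + j) % n ≡ (l + j) % n
  +-cong-% k l j eq = trans (%-distribˡ-+ k j n) (trans (cong (λ x → (x + j % n) % n) eq) (sym (%-distribˡ-+ l j n)))

  w-period : ∀ k → w (k + n) ≡ w k
  w-period k = w-cong (k + n) k ([m+n]%n≡m%n k n)

  index : Fin n → Fin n
  index v = proj₁ (injective⇒onto hc hc-inj v)

  hc-index : ∀ v → hc (index v) ≡ v
  hc-index v = proj₂ (injective⇒onto hc hc-inj v)

  index-hc : ∀ i → index (hc i) ≡ i
  index-hc i = hc-inj (hc-index (hc i))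

  position : Fin n → ℕ
  position v = toℕ (index v)

  w-position : ∀ v → w (position v) ≡ v
  w-position v = trans (cong hc (toℕ-injective (trans (toℕ-mod (position v)) (m<n⇒m%n≡m (toℕ<n (index v)))))) (hc-index v)

  position-w : ∀ k → position (w k) ≡ k % n
  position-w k = trans (cong toℕ (index-hc (k mod n))) (toℕ-mod k)

  shift-position : ∀ k j → w (position (w k) + j) ≡ w (k + j)
  shift-position k j = w-cong (position (w k) + j) (k + j)
    (+-cong-% (position (w k)) k j (trans (cong (_% n) (position-w k)) (m%n%n≡m%n k n)))

  nxt prv : Fin n → Fin n
  nxt v = w (position v + 1)
  -- One step back is `N = n - 1` steps forward, which avoids subtraction.
  prv v = w (position v + N)

  nxt-w : ∀ k → nxt (w k) ≡ w (suc k)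
  nxt-w k = trans (shift-position k 1) (cong w (+-comm k 1))

  nxt-prv : ∀ v → nxt (prv v) ≡ v
  nxt-prv v = trans (nxt-w (position v + N)) (trans (cong w (sym (+-suc (position v) N)))
    (trans (w-period (position v)) (w-position v)))

  prv-w : ∀ k → prv (w (suc k)) ≡ w k
  prv-w k = trans (shift-position (suc k) N) (trans (cong w (sym (+-suc k N))) (w-period k))

  prv-nxt : ∀ v → prv (nxt v) ≡ v
  prv-nxt v = trans (cong (prv ∘ w) (+-comm (position v) 1)) (trans (prv-w (position v)) (w-position v))

  -- Otherwise two steps lead back to the start, so 2 + k ≡ k modulo n. Adding `k * N` turns k into
  -- the multiple `k * n` and leaves 2 ≡ 0, against n ≥ 3.
  nxt≢prv : ∀ v → nxt v ≢ prv v
  nxt≢prv v eq = absurd (trans (sym two) (trans (w-reflects (2 + k + k * N) (k * n) loop′) (m*n%n≡0 k n)))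
    where
    absurd : 2 ≢ 0
    absurd ()
    k : ℕ
    k = position v
    loop : w (2 + k) ≡ w k
    loop = begin
      w (2 + k)     ≡⟨ nxt-w (suc k) ⟨
      nxt (w (suc k)) ≡⟨ cong (nxt ∘ w) (+-comm 1 k) ⟩
      nxt (nxt v)   ≡⟨ cong nxt eq ⟩
      nxt (prv v)   ≡⟨ nxt-prv v ⟩
      v             ≡⟨ w-position v ⟨
      w k           ∎
      where open ≡-Reasoning
    loop′ : w (2 + k + k * N) ≡ w (k * n)
    loop′ = trans (w-cong (2 + k + k * N) (k + k * N) (+-cong-% (2 + k) k (k * N) (w-reflects (2 + k) k loop)))
      (cong w (sym (*-suc k N)))
    two : (2 + k + k * N) % n ≡ 2
    two = trans (cong (λ x → (2 + x) % n) (sym (*-suc k N))) (trans ([m+kn]%n≡m%n 2 k n) (m<n⇒m%n≡m (s≤s 2≤N)))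

  cyclic : ∀ {k} (f : Fin n → Fin k) → (∀ v → f (nxt v) ≡ f v) → ∀ u v → f u ≡ f v
  cyclic f f-nxt u v = trans (to-start u) (sym (to-start v))
    where
    along-cycle : ∀ k → f (w k) ≡ f (w 0)
    along-cycle zero = refl
    along-cycle (suc k) = trans (cong f (sym (nxt-w k))) (trans (f-nxt (w k)) (along-cycle k))
    to-start : ∀ v → f v ≡ f (w 0)
    to-start v = trans (cong f (sym (w-position v))) (along-cycle (position v))

  adj-w : ∀ k → Adj G (w k) (w (suc k))
  adj-w k = hc-adj (k mod n) (suc k mod n) (case (m≤n⇒m<n∨m≡n (m%n<n k n)))
    where
    next : suc k % n ≡ suc (k % n) % n
    next = trans (cong (_% n) (+-comm 1 k)) (trans (+-cong-% k (k % n) 1 (sym (m%n%n≡m%n k n)))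
      (cong (_% n) (+-comm (k % n) 1)))
    case : suc (k % n) < n ⊎ suc (k % n) ≡ n → _
    case (inj₁ <n) = inj₁ (trans (cong suc (toℕ-mod k)) (sym (trans (toℕ-mod (suc k)) (trans next (m<n⇒m%n≡m <n)))))
    case (inj₂ ≡n) = inj₂ (trans (cong suc (toℕ-mod k)) ≡n ,
      trans (toℕ-mod (suc k)) (trans next (trans (cong (_% n) ≡n) (n%n≡0 n))))

  adj-nxt : ∀ v → Adj G v (nxt v)
  adj-nxt v = subst₂ (Adj G) (w-position v) (cong w (+-comm 1 (position v))) (adj-w (position v))

  cycle : Cycle G
  cycle = record
    { nxt = nxt ; prv = prv
    ; h = λ v → proj₁ (adj-nxt v)
    -- Taken as the reverse of the dart chosen at `prv v`, so that both directions of a cycle edge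
    -- match.
    ; g = λ v → α (proj₁ (adj-nxt (prv v)))
    ; tail-h = λ v → proj₁ (proj₂ (adj-nxt v))
    ; tail-g = λ v → trans (proj₂ (proj₂ (adj-nxt (prv v)))) (nxt-prv v)
    ; α-h = λ v → cong (λ u → α (proj₁ (adj-nxt u))) (sym (prv-nxt v))
    ; α-g = λ v → α-invol _
    ; nxt-prv = nxt-prv ; prv-nxt = prv-nxt ; nxt≢prv = nxt≢prv ; cyclic = cyclic
    }

  w-onto : ∀ p v → ∃[ i ] (i < n × w (i + p) ≡ v)
  w-onto p v = i , m%n<n (j + p * N) n , (begin
    w (i + p)             ≡⟨ w-cong (i + p) (j + p * N + p) (+-cong-% i (j + p * N) p (m%n%n≡m%n (j + p * N) n)) ⟩
    w (j + p * N + p)     ≡⟨ cong w (regroup j p N) ⟩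
    w (j + p * n)         ≡⟨ w-cong (j + p * n) j ([m+kn]%n≡m%n j p n) ⟩
    w j                   ≡⟨ w-position v ⟩
    v                     ∎)
    where
    open ≡-Reasoning
    j i : ℕ
    j = position v
    -- Modulo `n` the number `N` is -1, so this is j - p.
    i = (j + p * N) % n
    regroup : ∀ j p N → j + p * N + p ≡ j + p * suc N
    regroup = solve-∀

  w-toℕ : ∀ i → w (toℕ i + 0) ≡ hc i
  w-toℕ i = trans (cong w (trans (+-identityʳ _) (cong toℕ (sym (index-hc i))))) (w-position (hc i))

  w-sum : ∀ f → range (f ∘ w) 0 n ≡ sum f
  w-sum f = begin
    range (f ∘ w) 0 n                 ≡⟨ sum-toℕ (f ∘ w) 0 n ⟨
    sum {n} (λ i → f (w (toℕ i + 0))) ≡⟨ sum-cong-≗ {n} (λ i → cong f (w-toℕ i)) ⟩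
    sum (f ∘ hc)                      ≡⟨ sum-reindex f hc index hc-index index-hc ⟩
    sum f                             ∎
    where open ≡-Reasoning

theorem4p2 : (n : ℕ) (G : PlaneTriangulation n) →
    MinDegreeAtLeast G 4 → HamiltonCycle G →
    DominationNumberAtMost G (bound n)
theorem4p2 (suc N) G degree (s≤s 2≤N , hc , hc-inj , hc-adj) =
  Positions.conclusion G degree cycle w nxt-w w-period w-onto w-sum
  where open Hamiltonian G 2≤N hc hc-inj hc-adj
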